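{- Let $\mathfrak{A}$ be a complete atomic weakly associative relation algebra, let $\mathfrak{B}=\langle B,T_\kappa,E_{\kappa\lambda}\rangle_{\kappa,\lambda<3}$ be its suitable structure, for every $t\in B$ let $R_t=\{\langle(p0)^{\mathfrak{B}},(p1)^{\mathfrak{B}},(p2)^{\mathfrak{B}}\rangle:p\in\mathrm{Tr}(\mathfrak{B}),\ p\text{ ends at }t\}$, and let $\mathfrak{C}$ be the subalgebra of the full 3-dimensional cylindric set algebra on $U(\mathfrak{B})$ completely generated by $\{R_t:t\in B\}$. Then $\mathfrak{A}\cong\mathfrak{Ra}\,\mathfrak{Rl}_{V(\mathfrak{B})}(\mathfrak{C})$, and $\{R_t:t\in B\}$ is the set of atoms of $\mathfrak{Rl}_{V(\mathfrak{B})}(\mathfrak{C})$.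
   Context: WA: algebras $\langle A,+,\overline{\phantom{x}},;,\breve{\phantom{x}},1'\rangle$ with $x\cdot y=\overline{\overline{x}+\overline{y}}$, $0'=\overline{1'}$, $1=1'+0'$, $0=\overline{1}$, satisfying for all $x,y,z$: $x+y=y+x$; $x+(y+z)=(x+y)+z$; $\overline{\overline{x}+\overline{y}}+\overline{\overline{x}+y}=x$; $((x\cdot 1');1);1=(x\cdot1');1$; $(x+y);z=x;z+y;z$; $x;1'=x$; $\breve{\breve{x}}=x$; $\breve{(x+y)}=\breve{x}+\breve{y}$; $\breve{(x;y)}=\breve{y};\breve{x}$; $\breve{x};\overline{x;y}+\overline{y}=\overline{y}$. $\mathrm{At}(\mathfrak{A})$ = atoms. Suitable structure: $B=\{s\in{}^3\mathrm{At}(\mathfrak{A}): s_2;s_0\ge s_1\}$; $T_\kappa=\{\langle s,t\rangle\in B\times B:s_\kappa=t_\kappa\}$; $E_{\kappa\kappa}=B$; for distinct $\kappa,\lambda$ with third index $\mu$, $E_{\kappa\lambda}=\{s\in B:s_\mu\le1'\}$. Trails: a $\mathfrak{B}$-trail is $p=\langle t_0,\kappa_0,\dots,t_n,\kappa_n\rangle$, $n\in\omega$, $t_i\in B$, $\kappa_i<3$, with $t_i\ne t_{i+1}$ and $\langle t_i,t_{i+1}\rangle\in T_{\kappa_i}$ for $i<n$; it ends at $t_n$. $\mathrm{Tr}(\mathfrak{B})$ = set of trails; $p\lambda=\langle t_0,\kappa_0,\dots,t_n,\lambda\rangle$. $\approx$ is the smallest equivalence relation on $\mathrm{Tr}(\mathfrak{B})$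 with (for trails of the displayed forms): (a) $\langle t_0,\kappa_0,\dots,t_i,\lambda,s,\lambda,t_i,\kappa_i,\dots,t_n,\kappa_n\rangle\approx\langle t_0,\kappa_0,\dots,t_i,\kappa_i,\dots,t_n,\kappa_n\rangle$; (b) $\langle t_0,\kappa_0,\dots,t_n,\lambda,s,\nu\rangle\approx\langle t_0,\kappa_0,\dots,t_n,\nu\rangle$ if $\lambda\ne\nu$; (c) $\langle t_0,\kappa_0,\dots,t_n,\lambda\rangle\approx\langle t_0,\kappa_0,\dots,t_n,\kappa_n\rangle$ if $t_n\in E_{\lambda\kappa_n}$. $p^{\mathfrak{B}}$ = $\approx$-class; $U(\mathfrak{B})=\{p^{\mathfrak{B}}:p\in\mathrm{Tr}(\mathfrak{B})\}$; $V(\mathfrak{B})=\bigcup_{t\in B}R_t$. The full cylindric set algebra on $U$: $\langle\mathcal{P}({}^3U),\cup,{}^3U\setminus\cdot,C_\kappa,D_{\kappa\lambda}\rangle_{\kappa,\lambda<3}$, $C_\kappa X=\{v\in{}^3U:\exists u\in X\ \forall\lambda\ne\kappa\ u_\lambda=v_\lambda\}$, $D_{\kappa\lambda}=\{v:v_\kappa=v_\lambda\}$; "completely generated" means the smallest subalgebra closed also under arbitrary unions. $\mathfrak{Rl}_V(\mathfrak{C})$: universe $\{X\in C:X\subseteq V\}$, operations $\cup$, $V\setminus\cdot$, $C^{[V]}_\kappa X=V\cap C_\kappa X$, constants $D^{[V]}_{\kappa\lambda}=V\cap D_{\kappa\lambda}$. Relation-algebraic reduct: for $\mathfrak{D}=\langle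 D,+,\overline{\phantom{x}},c_\kappa,d_{\kappa\lambda}\rangle_{\kappa,\lambda<3}$, $Nr_2\mathfrak{D}=\{x:c_2x=x\}$, $x;y=c_2(c_1(d_{12}\cdot x)\cdot c_0(d_{02}\cdot y))$, $\breve{x}=c_2(d_{20}\cdot c_0(d_{01}\cdot c_1(d_{12}\cdot x)))$, $\mathfrak{Ra}\,\mathfrak{D}=\langle Nr_2\mathfrak{D},+,\overline{\phantom{x}},;,\breve{\phantom{x}},d_{01}\rangle$. -}

module Defs where

open import Level using (Level; _⊔_; suc)
open import Algebra.Core using (Op₁; Op₂)
import Algebra.Definitions as AlgebraDefinitions
import Algebra.Morphism.Definitions as MorphismDefinitions
open import Axiom.ExcludedMiddle using (ExcludedMiddle)
open import Data.Fin.Base using (Fin)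
open import Data.Fin.Patterns using (0F; 1F; 2F)
open import Data.List.Base using (List; []; _∷_; _++_; _∷ʳ_)
open import Data.List.Relation.Unary.Linked using (Linked; [-]; _∷_)
open import Data.List.Relation.Binary.Pointwise.Base as List using ()
open import Data.Product.Base using (∃; _×_; _,_; proj₁; proj₂)
open import Data.Product.Relation.Binary.Pointwise.NonDependent using (×-setoid)
open import Data.Sum.Base using (_⊎_; inj₁; inj₂; [_,_])
open import Data.Vec.Functional using (Vector)
open import Data.Vec.Functional.Relation.Binary.Pointwise using (Pointwise)
open import Function.Base using (_∘_; _on_)
open import Function.Definitions using (Congruent; Injective; Surjective)
open import Relation.Binary.Bundles using (Setoid)
open import Relation.Binary.Core using (Rel)
open import Relation.Binary.Definitions using (_Respects_)
open import Relation.Binary.Structures using (IsEquivalence)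
import Relation.Binary.Construct.Closure.Equivalence as Closure
open import Relation.Binary.PropositionalEquality.Core using (_≡_; _≢_)
open import Relation.Nullary.Decidable.Core using (decidable-stable)
open import Relation.Nullary.Negation.Core using (¬_)
open import Relation.Unary using (Pred; _∈_; _⊆_; _≐_; _∪_; _∩_; ∁; ⋃)

private
  variable
    a b c ℓ ℓ₁ ℓ₂ r u : Level

module BooleanOrder {A : Set a} (_≈_ : Rel A ℓ) (_+_ : Op₂ A) (0# : A) where

  infix 4 _≤_

  _≤_ : Rel A ℓ
  x ≤ y = (x + y) ≈ y

  IsSupremum : Pred A r → A → Set _
  IsSupremum P s = (∀ x → x ∈ P → x ≤ s) × (∀ y → (∀ x → x ∈ P → x ≤ y) → s ≤ y)

  IsAtom : Pred A (a ⊔ ℓ)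
  IsAtom x = ¬ (x ≈ 0#) × (∀ y → y ≤ x → y ≈ 0# ⊎ y ≈ x)

  -- Classically the universe level at which subsets are taken is
  -- immaterial.
  IsComplete : Set (suc (a ⊔ ℓ))
  IsComplete = ∀ (P : Pred A (a ⊔ ℓ)) → ∃ (IsSupremum P)

  IsAtomic : Set (a ⊔ ℓ)
  IsAtomic = ∀ x → ¬ (x ≈ 0#) → ∃ λ y → IsAtom y × y ≤ x

record RawRA (c ℓ : Level) : Set (suc (c ⊔ ℓ)) where
  infix  4 _≈_
  infixl 6 _+_
  infixl 7 _·_ _⨾_
  infix  8 ¯_ _˘
  field
    Carrier : Set c
    _≈_     : Rel Carrier ℓ
    _+_     : Op₂ Carrier
    ¯_      : Op₁ Carrier
    _⨾_     : Op₂ Carrier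
    _˘      : Op₁ Carrier
    1′      : Carrier

  _·_ : Op₂ Carrier
  x · y = ¯ (¯ x + ¯ y)

  0′ 1# 0# : Carrier
  0′ = ¯ 1′
  1# = 1′ + 0′
  0# = ¯ 1#

  open BooleanOrder _≈_ _+_ 0# public

record IsWA (𝔄 : RawRA c ℓ) : Set (c ⊔ ℓ) where
  open RawRA 𝔄
  open AlgebraDefinitions _≈_
  field
    isEquivalence : IsEquivalence _≈_
    +-cong        : Congruent₂ _+_
    ¯-cong        : Congruent₁ ¯_
    ⨾-cong        : Congruent₂ _⨾_
    ˘-cong        : Congruent₁ _˘

    +-comm        : Commutative _+_
    +-assoc       : Associative _+_
    huntington    : ∀ x y → ¯ (¯ x + ¯ y) + ¯ (¯ x + y) ≈ x
    ⨾-weakAssoc   : ∀ x → ((x · 1′) ⨾ 1#) ⨾ 1# ≈ (x · 1′) ⨾ 1#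
    ⨾-distribʳ-+  : _⨾_ DistributesOverʳ _+_
    ⨾-identityʳ   : RightIdentity 1′ _⨾_
    ˘-involutive  : Involutive _˘
    ˘-distrib-+   : ∀ x y → (x + y) ˘ ≈ x ˘ + y ˘
    ˘-antidistrib : ∀ x y → (x ⨾ y) ˘ ≈ y ˘ ⨾ x ˘
    residuation   : ∀ x y → x ˘ ⨾ ¯ (x ⨾ y) + ¯ y ≈ ¯ y

record _≅_ (𝔄 : RawRA a ℓ₁) (𝔅 : RawRA b ℓ₂) : Set (a ⊔ ℓ₁ ⊔ b ⊔ ℓ₂) where
  private
    module A = RawRA 𝔄
    module B = RawRA 𝔅
  open MorphismDefinitions A.Carrier B.Carrier B._≈_
  field
    ⟦_⟧        : A.Carrier → B.Carrier
    cong       : Congruent A._≈_ B._≈_ ⟦_⟧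
    +-homo     : Homomorphic₂ ⟦_⟧ A._+_ B._+_
    ¯-homo     : Homomorphic₁ ⟦_⟧ A.¯_ B.¯_
    ⨾-homo     : Homomorphic₂ ⟦_⟧ A._⨾_ B._⨾_
    ˘-homo     : Homomorphic₁ ⟦_⟧ A._˘ B._˘
    1′-homo    : Homomorphic₀ ⟦_⟧ A.1′ B.1′
    injective  : Injective A._≈_ B._≈_ ⟦_⟧
    surjective : Surjective A._≈_ B._≈_ ⟦_⟧

record RawCA₃ (c ℓ : Level) : Set (suc (c ⊔ ℓ)) where
  infix  4 _≈_
  infixl 6 _+_
  infixl 7 _·_
  infix  8 ¯_
  field
    Carrier : Set c
    _≈_     : Rel Carrier ℓ
    _+_     : Op₂ Carrier
    ¯_      : Op₁ Carrier
    𝐜       : Fin 3 → Op₁ Carrier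
    𝐝       : Fin 3 → Fin 3 → Carrier

  _·_ : Op₂ Carrier
  x · y = ¯ (¯ x + ¯ y)

  1# 0# : Carrier
  1# = 𝐝 0F 0F + ¯ 𝐝 0F 0F
  0# = ¯ 1#

  open BooleanOrder _≈_ _+_ 0# public

  Nr₂ : Pred Carrier ℓ
  Nr₂ x = 𝐜 2F x ≈ x

-- What is needed of 𝔇 for Nr₂ 𝔇 to be closed under the operations of
-- the relation-algebraic reduct.
record HasNr₂ (𝔇 : RawCA₃ c ℓ) : Set (c ⊔ ℓ) where
  open RawCA₃ 𝔇
  field
    +-closed : ∀ {x y} → Nr₂ x → Nr₂ y → Nr₂ (x + y)
    ¯-closed : ∀ {x} → Nr₂ x → Nr₂ (¯ x)
    𝐜-closed : ∀ x → Nr₂ (𝐜 2F x)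
    𝐝-closed : Nr₂ (𝐝 0F 1F)

Ra : (𝔇 : RawCA₃ c ℓ) → HasNr₂ 𝔇 → RawRA (c ⊔ ℓ) ℓ
Ra 𝔇 closed = record
  { Carrier = ∃ Nr₂
  ; _≈_     = _≈_ on proj₁
  ; _+_     = λ (x , x∈) (y , y∈) → x + y , +-closed x∈ y∈
  ; ¯_      = λ (x , x∈) → ¯ x , ¯-closed x∈
  ; _⨾_     = λ (x , _) (y , _) →
      𝐜 2F (𝐜 1F (𝐝 1F 2F · x) · 𝐜 0F (𝐝 0F 2F · y)) , 𝐜-closed _
  ; _˘      = λ (x , _) →
      𝐜 2F (𝐝 2F 0F · 𝐜 0F (𝐝 0F 1F · 𝐜 1F (𝐝 1F 2F · x))) , 𝐜-closed _
  ; 1′      = 𝐝 0F 1F , 𝐝-closed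
  }
  where
  open RawCA₃ 𝔇
  open HasNr₂ closed

module SetAlgebra (U : Setoid u u) where
  open Setoid U using ()
    renaming (Carrier to ∣U∣; _≈_ to _≈ᵤ_; refl to reflᵤ; sym to symᵤ; trans to transᵤ)

  U³ : Set u
  U³ = Vector ∣U∣ 3

  _≈³_ : Rel U³ u
  _≈³_ = Pointwise _≈ᵤ_

  -- 𝒫(³U): U is a setoid, standing for a set of equivalence classes, so
  -- its subsets are the predicates that respect its equality.
  record Subset : Set (suc u) where
    field
      Mem  : Pred U³ u
      resp : Mem Respects _≈³_
  open Subset public

  infix  4 _⊑_ _≋_
  infixr 6 _⊔ₛ_
  infixr 7 _⊓ₛ_

  _⊑_ _≋_ : Rel Subset u
  X ⊑ Y = Mem X ⊆ Mem Y
  X ≋ Y = Mem X ≐ Mem Y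

  _⊔ₛ_ _⊓ₛ_ : Op₂ Subset
  X ⊔ₛ Y = record
    { Mem  = Mem X ∪ Mem Y
    ; resp = λ e → [ inj₁ ∘ resp X e , inj₂ ∘ resp Y e ]
    }
  X ⊓ₛ Y = record
    { Mem  = Mem X ∩ Mem Y
    ; resp = λ e (x , y) → resp X e x , resp Y e y
    }

  ∁ₛ : Op₁ Subset
  ∁ₛ X = record
    { Mem  = ∁ (Mem X)
    ; resp = λ e x∉ x∈ → x∉ (resp X (symᵤ ∘ e) x∈)
    }

  ⋃ₛ : (I : Set u) → (I → Subset) → Subset
  ⋃ₛ I F = record
    { Mem  = ⋃ I (Mem ∘ F)
    ; resp = λ e (i , x) → i , resp (F i) e x
    }

  C : Fin 3 → Op₁ Subset
  C κ X = record
    { Mem  = λ v → ∃ λ w → w ∈ Mem X × (∀ ν → ν ≢ κ → w ν ≈ᵤ v ν)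
    ; resp = λ e (w , w∈ , f) → w , w∈ , λ ν ν≢κ → transᵤ (f ν ν≢κ) (e ν)
    }

  D : Fin 3 → Fin 3 → Subset
  D κ ν = record
    { Mem  = λ v → v κ ≈ᵤ v ν
    ; resp = λ e p → transᵤ (symᵤ (e κ)) (transᵤ p (e ν))
    }

  full : RawCA₃ (suc u) u
  full = record
    { Carrier = Subset
    ; _≈_     = _≋_
    ; _+_     = _⊔ₛ_
    ; ¯_      = ∁ₛ
    ; 𝐜       = C
    ; 𝐝       = D
    }

  record IsSubuniverse (S : Pred Subset ℓ) : Set (ℓ ⊔ suc u) where
    field
      ≋-closed : S Respects _≋_
      ⊔-closed : ∀ {X Y} → X ∈ S → Y ∈ S → X ⊔ₛ Y ∈ S
      ∁-closed : ∀ {X} → X ∈ S → ∁ₛ X ∈ S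
      C-closed : ∀ κ {X} → X ∈ S → C κ X ∈ S
      D-closed : ∀ κ ν → D κ ν ∈ S

  -- The smallest subuniverse of `full` that contains all G i and is
  -- closed under arbitrary unions.  Unions over index types in Set u
  -- suffice: classically every subset of U³ is given by a function
  -- U³ → Bool, so every family of subsets can be reindexed by a type in
  -- Set u without changing its union.
  data CompletelyGenerated {I : Set u} (G : I → Subset) : Pred Subset (suc u) where
    gen : ∀ i → CompletelyGenerated G (G i)
    ext : ∀ {X Y} → X ≋ Y → CompletelyGenerated G X → CompletelyGenerated G Y
    or  : ∀ {X Y} → CompletelyGenerated G X → CompletelyGenerated G Y →
          CompletelyGenerated G (X ⊔ₛ Y)
    not : ∀ {X} → CompletelyGenerated G X → CompletelyGenerated G (∁ₛ X)
    cyl : ∀ κ {X} → CompletelyGenerated G X → CompletelyGenerated G (C κ X)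
    dia : ∀ κ ν → CompletelyGenerated G (D κ ν)
    sup : ∀ {J : Set u} (F : J → Subset) →
          (∀ j → CompletelyGenerated G (F j)) → CompletelyGenerated G (⋃ₛ J F)

  isSubuniverse : {I : Set u} (G : I → Subset) → IsSubuniverse (CompletelyGenerated G)
  isSubuniverse G = record
    { ≋-closed = ext
    ; ⊔-closed = or
    ; ∁-closed = not
    ; C-closed = cyl
    ; D-closed = dia
    }

  -- Excluded middle is used only to see that a subuniverse, being closed
  -- under unions and complements, is closed under intersections.
  module Relativization (em : ExcludedMiddle u) {S : Pred Subset ℓ}
                        (sub : IsSubuniverse S) (V : Subset) (V∈S : V ∈ S) where
    open IsSubuniverse sub

    ⊓-closed : ∀ {X Y} → X ∈ S → Y ∈ S → X ⊓ₛ Y ∈ S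
    ⊓-closed X∈ Y∈ = ≋-closed
      ( (λ n → decidable-stable em (n ∘ inj₁) , decidable-stable em (n ∘ inj₂))
      , (λ (x , y) → [ (λ x∉ → x∉ x) , (λ y∉ → y∉ y) ]))
      (∁-closed (⊔-closed (∁-closed X∈) (∁-closed Y∈)))

    record RlSet : Set (ℓ ⊔ suc u) where
      field
        set : Subset
        ∈S  : set ∈ S
        ⊑V  : set ⊑ V
    open RlSet public

    Rl : RawCA₃ (ℓ ⊔ suc u) u
    Rl = record
      { Carrier = RlSet
      ; _≈_     = _≋_ on set
      ; _+_     = λ X Y → record
          { set = set X ⊔ₛ set Y
          ; ∈S  = ⊔-closed (∈S X) (∈S Y)
          ; ⊑V  = [ ⊑V X , ⊑V Y ]
          }
      ; ¯_      = λ X → record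
          { set = V ⊓ₛ ∁ₛ (set X)
          ; ∈S  = ⊓-closed V∈S (∁-closed (∈S X))
          ; ⊑V  = proj₁
          }
      ; 𝐜       = λ κ X → record
          { set = V ⊓ₛ C κ (set X)
          ; ∈S  = ⊓-closed V∈S (C-closed κ (∈S X))
          ; ⊑V  = proj₁
          }
      ; 𝐝       = λ κ ν → record
          { set = V ⊓ₛ D κ ν
          ; ∈S  = ⊓-closed V∈S (D-closed κ ν)
          ; ⊑V  = proj₁
          }
      }

    hasNr₂ : HasNr₂ Rl
    hasNr₂ = record
      { +-closed = λ {X} {Y} (X⊆ , _) (Y⊆ , _) →
            (λ { (v , w , inj₁ x , f) → inj₁ (X⊆ (v , w , x , f))
               ; (v , w , inj₂ y , f) → inj₂ (Y⊆ (v , w , y , f)) })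
          , (λ z → [ ⊑V X , ⊑V Y ] z , _ , z , λ _ _ → reflᵤ)
      ; ¯-closed = λ (X⊆ , _) →
            (λ (v , w , (w∈V , w∉) , f) →
              v , λ v∈ → w∉ (X⊆ (w∈V , _ , v∈ , λ ν ν≢2 → symᵤ (f ν ν≢2))))
          , (λ z → proj₁ z , _ , z , λ _ _ → reflᵤ)
      ; 𝐜-closed = λ X →
            (λ (v , w , (_ , w′ , x , g) , f) →
              v , w′ , x , λ ν ν≢2 → transᵤ (g ν ν≢2) (f ν ν≢2))
          , (λ z → proj₁ z , _ , z , λ _ _ → reflᵤ)
      ; 𝐝-closed =
            (λ (v , w , (_ , d) , f) →
              v , transᵤ (symᵤ (f 0F λ ())) (transᵤ d (f 1F λ ())))
          , (λ z → proj₁ z , _ , z , λ _ _ → reflᵤ)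
      }

record Structure (b r : Level) : Set (suc (b ⊔ r)) where
  field
    points : Setoid b r
    T      : Fin 3 → Rel (Setoid.Carrier points) r
    E      : Fin 3 → Fin 3 → Pred (Setoid.Carrier points) r

module Trails (𝔅 : Structure b r) where
  open Structure 𝔅
  open Setoid points using (_≈_) renaming (Carrier to B)
  open import Relation.Binary.PropositionalEquality.Properties using (setoid)

  Entry : Setoid b r
  Entry = ×-setoid points (setoid (Fin 3))

  ∣Entry∣ : Set b
  ∣Entry∣ = B × Fin 3

  Step : Rel ∣Entry∣ r
  Step (s , κ) (t , _) = ¬ (s ≈ t) × T κ s t

  -- ⟨t₀,κ₀,…,tₙ,κₙ⟩, with (tₙ , κₙ) = (end , index).
  record Trail : Set (b ⊔ r) where
    field
      init   : List ∣Entry∣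
      end    : B
      index  : Fin 3
      linked : Linked Step (init ∷ʳ (end , index))

    entries : List ∣Entry∣
    entries = init ∷ʳ (end , index)
  open Trail public

  relink : ∀ xs {t κ} ν → Linked Step (xs ∷ʳ (t , κ)) → Linked Step (xs ∷ʳ (t , ν))
  relink []           ν _        = [-]
  relink (x ∷ [])     ν (s ∷ _)  = s ∷ [-]
  relink (x ∷ y ∷ xs) ν (s ∷ ss) = s ∷ relink (y ∷ xs) ν ss

  infix 9 _⟨_⟩
  _⟨_⟩ : Trail → Fin 3 → Trail
  p ⟨ ν ⟩ = record { init = init p ; end = end p ; index = ν
                   ; linked = relink (init p) ν (linked p) }

  infix 4 _⟶_ _≈ₜ_

  -- Since points form a setoid, trails with pointwise equal entries have
  -- to be identified explicitly; this is `same`.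
  data _⟶_ (p q : Trail) : Set (b ⊔ r) where
    same : List.Pointwise (Setoid._≈_ Entry) (entries p) (entries q) → p ⟶ q
    back : ∀ xs t ν s κ ys →
           entries p ≡ xs ++ (t , ν) ∷ (s , ν) ∷ (t , κ) ∷ ys →
           entries q ≡ xs ++ (t , κ) ∷ ys → p ⟶ q
    drop : ∀ xs t ν s μ → ν ≢ μ →
           entries p ≡ xs ++ (t , ν) ∷ (s , μ) ∷ [] →
           entries q ≡ xs ++ (t , μ) ∷ [] → p ⟶ q
    turn : ∀ xs t ν κ → t ∈ E ν κ →
           entries p ≡ xs ++ (t , ν) ∷ [] →
           entries q ≡ xs ++ (t , κ) ∷ [] → p ⟶ q

  _≈ₜ_ : Rel Trail (b ⊔ r)
  _≈ₜ_ = Closure.EqClosure _⟶_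

  𝐔 : Setoid (b ⊔ r) (b ⊔ r)
  𝐔 = Closure.setoid _⟶_

  open SetAlgebra 𝐔 public

  R : B → Subset
  R t = record
    { Mem  = λ v → ∃ λ p → end p ≈ t × (∀ κ → v κ ≈ₜ p ⟨ κ ⟩)
    ; resp = λ e (p , p∈ , f) → p , p∈ , λ κ → trans (sym (e κ)) (f κ)
    }
    where open Setoid 𝐔 using (sym; trans)

module Suitable (𝔄 : RawRA c ℓ) (isEquivalence : IsEquivalence (RawRA._≈_ 𝔄)) where
  open RawRA 𝔄
  open IsEquivalence isEquivalence using (refl; sym; trans)

  At : Set (c ⊔ ℓ)
  At = ∃ IsAtom

  record Triple : Set (c ⊔ ℓ) where
    field
      atoms : Vector At 3
      cycle : proj₁ (atoms 1F) ≤ proj₁ (atoms 2F) ⨾ proj₁ (atoms 0F)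
  open Triple public

  infix 9 _$_
  _$_ : Triple → Fin 3 → Carrier
  s $ κ = proj₁ (atoms s κ)

  _≈ᵇ_ : Rel Triple ℓ
  s ≈ᵇ t = ∀ κ → s $ κ ≈ t $ κ

  -- In offDiagonal, μ is the third index.
  data Eᵇ (s : Triple) (κ : Fin 3) : Fin 3 → Set ℓ where
    diagonal    : Eᵇ s κ κ
    offDiagonal : ∀ {ν} μ → κ ≢ ν → μ ≢ κ → μ ≢ ν → s $ μ ≤ 1′ → Eᵇ s κ ν

  suitable : Structure (c ⊔ ℓ) ℓ
  suitable = record
    { points = record
        { Carrier       = Triple
        ; _≈_           = _≈ᵇ_
        ; isEquivalence = record
            { refl  = λ _ → refl
            ; sym   = λ e κ → sym (e κ)
            ; trans = λ e f κ → trans (e κ) (f κ)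
            }
        }
    ; T = λ κ s t → s $ κ ≈ t $ κ
    ; E = λ κ ν s → Eᵇ s κ ν
    }

module Representation (em : ∀ {p} → ExcludedMiddle p) (𝔄 : RawRA c ℓ) (isWA : IsWA 𝔄) where
  open Suitable 𝔄 (IsWA.isEquivalence isWA) public
  open Trails suitable public

  V : Subset
  V = ⋃ₛ Triple R

  ℭ : Pred Subset (suc (c ⊔ ℓ))
  ℭ = CompletelyGenerated R

  V∈ℭ : V ∈ ℭ
  V∈ℭ = sup R gen

  open Relativization em (isSubuniverse R) V V∈ℭ public

  Rᵉ : Triple → RlSet
  Rᵉ t = record { set = R t ; ∈S = gen t ; ⊑V = t ,_ }

{-# OPTIONS --safe #-}

-- A trail unfolds a triangle of atoms into a tree of triangles, of which U is
-- the set of vertices.  Two facts carry the proof.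
--
-- Homogeneity: if the triangles s and t share an edge, prefixing trails with
-- that edge exchanges the trails starting at s with those starting at t, and
-- is an involution of U that preserves every R t, hence every member of ℭ.
-- Composing such swaps moves any trail to the one-triangle trail at its end,
-- so a member of ℭ that meets R t contains it.
--
-- Labels: after moving p to a one-triangle trail, each trail q has a reduced
-- history, free of backtracking, that is invariant under the identifications
-- defining U.  If a vertex of p equals a vertex of q, then that vertex
-- survives along the whole of this history, and two vertices surviving
-- together keep the atom on the edge between them.  So the atom between two
-- vertices of a triangle depends only on the vertices, and
-- x ↦ ⋃ {R t : t₂ ≤ x} is the isomorphism.

module Submission where

open import Defs
open import Level using (_⊔_)
open import Algebra.Bundles using (CommutativeSemigroup)
import Algebra.Properties.CommutativeSemigroup as CommutativeSemigroupProperties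
open import Axiom.ExcludedMiddle using (ExcludedMiddle)
open import Data.Empty.Polymorphic using (⊥)
open import Data.Fin.Base using (Fin)
open import Data.Fin.Patterns using (0F; 1F; 2F)
open import Data.List.Base using (List; []; _∷_; _++_; _∷ʳ_)
open import Data.List.Relation.Binary.Pointwise as Pointwise using (Pointwise; []; _∷_)
open import Data.List.Relation.Unary.Linked as Linked using (Linked; [-]; _∷_)
open import Data.Product.Base as Product using (∃; _×_; _,_; proj₁; proj₂)
open import Data.Sum.Base as Sum using (_⊎_; inj₁; inj₂; [_,_]′; fromInj₁; fromInj₂)
open import Data.Unit.Polymorphic using (⊤; tt)
import Data.Vec.Functional as Vector
open import Function.Base using (_∘_)
open import Function.Bundles using (_⇔_; mk⇔; module Equivalence)
open import Function.Properties.Equivalence using (⇔-isEquivalence)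
open import Relation.Binary.Bundles using (Setoid)
import Relation.Binary.Construct.Closure.Equivalence as Closure
open import Relation.Binary.PropositionalEquality.Core
  using (_≡_; _≢_; refl; sym; trans; cong; subst)
import Relation.Binary.Reasoning.Setoid as SetoidReasoning
open import Relation.Binary.Structures using (IsEquivalence)
open import Relation.Nullary.Decidable.Core using (Dec; yes; no; decidable-stable)
open import Relation.Nullary.Negation.Core using (¬_; contradiction)
open import Relation.Unary using (Pred; _∈_)

-- Boolean algebra from Huntington's axiom.

module WeaklyAssociative {c ℓ} {𝔄 : RawRA c ℓ} (isWA : IsWA 𝔄) where
  open RawRA 𝔄
  open IsWA isWA
  open IsEquivalence isEquivalence using ()
    renaming (refl to ≈-refl; sym to ≈-sym; trans to ≈-trans)

  setoid : Setoid c ℓ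
  setoid = record { isEquivalence = isEquivalence }

  open SetoidReasoning setoid

  +-commutativeSemigroup : CommutativeSemigroup c ℓ
  +-commutativeSemigroup = record
    { isCommutativeSemigroup = record
      { isSemigroup = record
        { isMagma = record { isEquivalence = isEquivalence ; ∙-cong = +-cong }
        ; assoc   = +-assoc
        }
      ; comm = +-comm
      }
    }

  open CommutativeSemigroupProperties +-commutativeSemigroup using (interchange)

  +-congˡ : ∀ {x y z} → y ≈ z → x + y ≈ x + z
  +-congˡ = +-cong ≈-refl

  +-congʳ : ∀ {x y z} → y ≈ z → y + x ≈ z + x
  +-congʳ e = +-cong e ≈-refl

  -- Huntington's axiom splits each of x, ¯ x, y and ¯ y in two, and both
  -- sides become the sum of the same four elements.
  x+¯x≈y+¯y : ∀ x y → x + ¯ x ≈ y + ¯ y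
  x+¯x≈y+¯y x y = begin
    x + ¯ x
      ≈⟨ +-cong (huntington x (¯ y)) (huntington (¯ x) (¯ y)) ⟨
    (¯ (¯ x + ¯ ¯ y) + ¯ (¯ x + ¯ y)) + (¯ (¯ ¯ x + ¯ ¯ y) + ¯ (¯ ¯ x + ¯ y))
      ≈⟨ interchange _ _ _ _ ⟩
    (¯ (¯ x + ¯ ¯ y) + ¯ (¯ ¯ x + ¯ ¯ y)) + (¯ (¯ x + ¯ y) + ¯ (¯ ¯ x + ¯ y))
      ≈⟨ +-comm _ _ ⟩
    (¯ (¯ x + ¯ y) + ¯ (¯ ¯ x + ¯ y)) + (¯ (¯ x + ¯ ¯ y) + ¯ (¯ ¯ x + ¯ ¯ y))
      ≈⟨ +-cong (+-comm _ _) (+-comm _ _) ⟩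
    (¯ (¯ ¯ x + ¯ y) + ¯ (¯ x + ¯ y)) + (¯ (¯ ¯ x + ¯ ¯ y) + ¯ (¯ x + ¯ ¯ y))
      ≈⟨ +-cong (+-cong (¯-cong (+-comm _ _)) (¯-cong (+-comm _ _)))
                (+-cong (¯-cong (+-comm _ _)) (¯-cong (+-comm _ _))) ⟩
    (¯ (¯ y + ¯ ¯ x) + ¯ (¯ y + ¯ x)) + (¯ (¯ ¯ y + ¯ ¯ x) + ¯ (¯ ¯ y + ¯ x))
      ≈⟨ +-cong (huntington y (¯ x)) (huntington (¯ y) (¯ x)) ⟩
    y + ¯ y ∎

  +-complementʳ : ∀ x → x + ¯ x ≈ 1#
  +-complementʳ x = x+¯x≈y+¯y x 1′

  -- Huntington's axiom for `¯ ¯ x` split by `¯ x` and for `x` split by `¯ ¯ x` gives the same two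
  -- summands, because `x + ¯ x` does not depend on `x`.
  ¯-involutive : ∀ x → ¯ ¯ x ≈ x
  ¯-involutive x = begin
    ¯ ¯ x                                    ≈⟨ huntington (¯ ¯ x) (¯ x) ⟨
    ¯ (¯ ¯ ¯ x + ¯ ¯ x) + ¯ (¯ ¯ ¯ x + ¯ x)  ≈⟨ +-cong (¯-cong (begin
      ¯ ¯ ¯ x + ¯ ¯ x  ≈⟨ +-comm _ _ ⟩
      ¯ ¯ x + ¯ ¯ ¯ x  ≈⟨ x+¯x≈y+¯y _ _ ⟩
      ¯ x + ¯ ¯ x      ∎)) (¯-cong (+-comm _ _)) ⟩
    ¯ (¯ x + ¯ ¯ x) + ¯ (¯ x + ¯ ¯ ¯ x)      ≈⟨ +-comm _ _ ⟩
    ¯ (¯ x + ¯ ¯ ¯ x) + ¯ (¯ x + ¯ ¯ x)      ≈⟨ huntington x (¯ ¯ x) ⟩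
    x                                        ∎

  +-complementˡ : ∀ x → ¯ x + x ≈ 1#
  +-complementˡ x = ≈-trans (+-comm _ _) (+-complementʳ x)

  huntington-diagonal : ∀ x → ¯ (¯ x + ¯ x) + 0# ≈ x
  huntington-diagonal x =
    ≈-trans (+-congˡ (¯-cong (≈-sym (+-complementˡ x)))) (huntington x x)

  -- Let m be `¯ (1# + 1#)`. The diagonal case of Huntington's axiom at `0#` yields m + 0 = 0, so 1
  -- absorbs m, and 1 + 1 = 1 + (1 + m) is a sum of complements.
  1+1≈1 : 1# + 1# ≈ 1#
  1+1≈1 = begin
    1# + 1#                   ≈⟨ +-congˡ 1+m≈1 ⟨
    1# + (1# + ¯ (1# + 1#))   ≈⟨ +-assoc _ _ _ ⟨
    (1# + 1#) + ¯ (1# + 1#)   ≈⟨ +-complementʳ _ ⟩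
    1#                        ∎
    where
    m+0≈0 : ¯ (1# + 1#) + 0# ≈ 0#
    m+0≈0 = begin
      ¯ (1# + 1#) + 0#        ≈⟨ +-congʳ (¯-cong (+-cong (¯-involutive _) (¯-involutive _))) ⟨
      ¯ (¯ 0# + ¯ 0#) + 0#    ≈⟨ huntington-diagonal 0# ⟩
      0#                      ∎
    1+m≈1 : 1# + ¯ (1# + 1#) ≈ 1#
    1+m≈1 = begin
      1# + ¯ (1# + 1#)         ≈⟨ +-congʳ (+-complementʳ 1#) ⟨
      (1# + 0#) + ¯ (1# + 1#)  ≈⟨ +-assoc _ _ _ ⟩
      1# + (0# + ¯ (1# + 1#))  ≈⟨ +-congˡ (≈-trans (+-comm _ _) m+0≈0) ⟩
      1# + 0#                  ≈⟨ +-complementʳ 1# ⟩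
      1#                       ∎

  0+0≈0 : 0# + 0# ≈ 0#
  0+0≈0 = begin
    0# + 0#                 ≈⟨ +-congʳ (¯-cong 1+1≈1) ⟨
    ¯ (1# + 1#) + 0#        ≈⟨ +-congʳ (¯-cong (+-cong (¯-involutive _) (¯-involutive _))) ⟨
    ¯ (¯ 0# + ¯ 0#) + 0#    ≈⟨ huntington-diagonal 0# ⟩
    0#                      ∎

  +-identityʳ : ∀ x → x + 0# ≈ x
  +-identityʳ x = begin
    x + 0#                        ≈⟨ +-congʳ (huntington-diagonal x) ⟨
    (¯ (¯ x + ¯ x) + 0#) + 0#     ≈⟨ +-assoc _ _ _ ⟩
    ¯ (¯ x + ¯ x) + (0# + 0#)     ≈⟨ +-congˡ 0+0≈0 ⟩
    ¯ (¯ x + ¯ x) + 0#            ≈⟨ huntington-diagonal x ⟩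
    x                             ∎

  +-idem : ∀ x → x + x ≈ x
  +-idem x = begin
    x + x                 ≈⟨ ¯-involutive _ ⟨
    ¯ ¯ (x + x)           ≈⟨ ¯-cong (begin
      ¯ (x + x)               ≈⟨ ¯-cong (+-cong (¯-involutive x) (¯-involutive x)) ⟨
      ¯ (¯ ¯ x + ¯ ¯ x)       ≈⟨ +-identityʳ _ ⟨
      ¯ (¯ ¯ x + ¯ ¯ x) + 0#  ≈⟨ huntington-diagonal (¯ x) ⟩
      ¯ x                     ∎) ⟩
    ¯ ¯ x                 ≈⟨ ¯-involutive x ⟩
    x                     ∎

  ≤-reflexive : ∀ {x y} → x ≈ y → x ≤ y
  ≤-reflexive {x} {y} e = ≈-trans (+-congʳ e) (+-idem y)

  ≤-refl : ∀ {x} → x ≤ x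
  ≤-refl = ≤-reflexive ≈-refl

  ≤-trans : ∀ {x y z} → x ≤ y → y ≤ z → x ≤ z
  ≤-trans {x} {y} {z} p q = begin
    x + z        ≈⟨ +-congˡ q ⟨
    x + (y + z)  ≈⟨ +-assoc _ _ _ ⟨
    (x + y) + z  ≈⟨ +-congʳ p ⟩
    y + z        ≈⟨ q ⟩
    z            ∎

  ≤-antisym : ∀ {x y} → x ≤ y → y ≤ x → x ≈ y
  ≤-antisym p q = ≈-trans (≈-sym q) (≈-trans (+-comm _ _) p)

  ≤-respʳ-≈ : ∀ {x y z} → y ≈ z → x ≤ y → x ≤ z
  ≤-respʳ-≈ e p = ≤-trans p (≤-reflexive e)

  ≤-respˡ-≈ : ∀ {x y z} → y ≈ z → y ≤ x → z ≤ x
  ≤-respˡ-≈ e p = ≤-trans (≤-reflexive (≈-sym e)) p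

  x≤x+y : ∀ x y → x ≤ x + y
  x≤x+y x y = ≈-trans (≈-sym (+-assoc x x y)) (+-congʳ (+-idem x))

  y≤x+y : ∀ x y → y ≤ x + y
  y≤x+y x y = ≤-respʳ-≈ (+-comm y x) (x≤x+y y x)

  +-lub : ∀ {x y z} → x ≤ z → y ≤ z → x + y ≤ z
  +-lub {x} {y} {z} p q = ≈-trans (+-assoc x y z) (≈-trans (+-congˡ q) p)

  0≤x : ∀ x → 0# ≤ x
  0≤x x = ≈-trans (+-comm _ _) (+-identityʳ x)

  x≤1 : ∀ x → x ≤ 1#
  x≤1 x = ≤-respʳ-≈ (+-complementʳ x) (x≤x+y x (¯ x))

  x·y≤x : ∀ x y → x · y ≤ x
  x·y≤x x y = ≤-respʳ-≈ (huntington x y) (x≤x+y _ _)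

  ¯-antitone : ∀ {x y} → x ≤ y → ¯ y ≤ ¯ x
  ¯-antitone {x} {y} p = ≤-respˡ-≈
    (¯-cong (≈-trans (+-cong (¯-involutive x) (¯-involutive y)) p))
    (x·y≤x (¯ x) (¯ y))

  x·y≤y : ∀ x y → x · y ≤ y
  x·y≤y x y = ≤-respˡ-≈ (¯-cong (+-comm _ _)) (x·y≤x y x)

  ·-glb : ∀ {x y z} → z ≤ x → z ≤ y → z ≤ x · y
  ·-glb {z = z} p q =
    ≤-respˡ-≈ (¯-involutive z) (¯-antitone (+-lub (¯-antitone p) (¯-antitone q)))

  ¯-swap : ∀ {x y} → x ≤ ¯ y → y ≤ ¯ x
  ¯-swap {y = y} p = ≤-respˡ-≈ (¯-involutive y) (¯-antitone p)

  x≤0⇒x≈0 : ∀ {x} → x ≤ 0# → x ≈ 0#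
  x≤0⇒x≈0 p = ≤-antisym p (0≤x _)

  x·¯x≈0 : ∀ x → x · ¯ x ≈ 0#
  x·¯x≈0 x = ¯-cong (+-complementʳ (¯ x))

  -- Huntington's axiom reads x = x·y + x·¯y; with the first summand gone, x is x·¯y.
  x·y≈0⇒x≤¯y : ∀ {x y} → x · y ≈ 0# → x ≤ ¯ y
  x·y≈0⇒x≤¯y {x} {y} p = ≤-respˡ-≈ (begin
    x · ¯ y                    ≈⟨ ¯-cong (+-congˡ (¯-involutive y)) ⟩
    ¯ (¯ x + y)                ≈⟨ +-identityʳ _ ⟨
    ¯ (¯ x + y) + 0#           ≈⟨ +-comm _ _ ⟩
    0# + ¯ (¯ x + y)           ≈⟨ +-congʳ p ⟨
    x · y + ¯ (¯ x + y)        ≈⟨ huntington x y ⟩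
    x                          ∎) (x·y≤y x (¯ y))

  -- Atoms of the Boolean algebra.

  module _ {a} (atom : IsAtom a) where

    atom-nonzero : ¬ (a ≈ 0#)
    atom-nonzero = proj₁ atom

    atom-≤-or-≤¯ : ∀ x → a ≤ x ⊎ a ≤ ¯ x
    atom-≤-or-≤¯ x = Sum.swap (Sum.map x·y≈0⇒x≤¯y (λ e → ≤-respˡ-≈ e (x·y≤y a x))
      (proj₂ atom (a · x) (x·y≤x a x)))

    atom-disjoint : ∀ {x} → a ≤ x → ¬ (a ≤ ¯ x)
    atom-disjoint p q =
      atom-nonzero (x≤0⇒x≈0 (≤-respʳ-≈ (x·¯x≈0 _) (·-glb p q)))

    atom-irrefl : ¬ (a ≤ ¯ a)
    atom-irrefl = atom-disjoint ≤-refl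

    atom-prime : ∀ {x y} → a ≤ x + y → a ≤ x ⊎ a ≤ y
    atom-prime {x} {y} p = Sum.map₂
      (λ a≤¯x → fromInj₁ (λ a≤¯y → contradiction (a≤¯[x+y] a≤¯x a≤¯y) (atom-disjoint p))
        (atom-≤-or-≤¯ y))
      (atom-≤-or-≤¯ x)
      where
      a≤¯[x+y] : a ≤ ¯ x → a ≤ ¯ y → a ≤ ¯ (x + y)
      a≤¯[x+y] q r =
        ≤-respʳ-≈ (¯-cong (+-cong (¯-involutive x) (¯-involutive y))) (·-glb {¯ x} {¯ y} {a} q r)

    ≤-atom : ∀ {x} → ¬ (x ≈ 0#) → x ≤ a → x ≈ a
    ≤-atom x≉0 p = fromInj₂ (λ e → contradiction e x≉0) (proj₂ atom _ p)

  atoms-≤⇒≈ : ∀ {x y} → IsAtom x → IsAtom y → x ≤ y → x ≈ y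
  atoms-≤⇒≈ atomˣ atomʸ = ≤-atom atomʸ (proj₁ atomˣ)

  -- Converse, composition and subidentity elements.

  ˘-mono : ∀ {x y} → x ≤ y → x ˘ ≤ y ˘
  ˘-mono p = ≈-trans (≈-sym (˘-distrib-+ _ _)) (˘-cong p)

  ˘-swap : ∀ {x y} → x ˘ ≤ y → x ≤ y ˘
  ˘-swap {x} p = ≤-respˡ-≈ (˘-involutive x) (˘-mono p)

  ⨾-monoˡ : ∀ {x y z} → x ≤ y → x ⨾ z ≤ y ⨾ z
  ⨾-monoˡ p = ≈-trans (≈-sym (⨾-distribʳ-+ _ _ _)) (⨾-cong p ≈-refl)

  ⨾-monoʳ : ∀ {x y z} → x ≤ y → z ⨾ x ≤ z ⨾ y
  ⨾-monoʳ {x} {y} {z} p = ≤-respˡ-≈ (˘-involutive _) (≤-respʳ-≈ (˘-involutive _)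
    (˘-mono (≤-respˡ-≈ (≈-sym (˘-antidistrib z x)) (≤-respʳ-≈ (≈-sym (˘-antidistrib z y))
      (⨾-monoˡ (˘-mono p))))))

  ⨾-mono : ∀ {x y z w} → x ≤ y → z ≤ w → x ⨾ z ≤ y ⨾ w
  ⨾-mono p q = ≤-trans (⨾-monoˡ p) (⨾-monoʳ q)

  1′-˘ : 1′ ˘ ≈ 1′
  1′-˘ = begin
    1′ ˘               ≈⟨ ⨾-identityʳ _ ⟨
    1′ ˘ ⨾ 1′          ≈⟨ ⨾-cong ≈-refl (˘-involutive 1′) ⟨
    1′ ˘ ⨾ 1′ ˘ ˘      ≈⟨ ˘-antidistrib (1′ ˘) 1′ ⟨
    (1′ ˘ ⨾ 1′) ˘      ≈⟨ ˘-cong (⨾-identityʳ _) ⟩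
    1′ ˘ ˘             ≈⟨ ˘-involutive 1′ ⟩
    1′                 ∎

  ⨾-identityˡ : ∀ x → 1′ ⨾ x ≈ x
  ⨾-identityˡ x = begin
    1′ ⨾ x             ≈⟨ ˘-involutive _ ⟨
    (1′ ⨾ x) ˘ ˘       ≈⟨ ˘-cong (˘-antidistrib 1′ x) ⟩
    (x ˘ ⨾ 1′ ˘) ˘     ≈⟨ ˘-cong (≈-trans (⨾-cong ≈-refl 1′-˘) (⨾-identityʳ _)) ⟩
    x ˘ ˘              ≈⟨ ˘-involutive x ⟩
    x                  ∎

  ˘-subidentity : ∀ {x} → x ≤ 1′ → x ˘ ≤ 1′
  ˘-subidentity p = ≤-respʳ-≈ 1′-˘ (˘-mono p)

  -- The axiom `residuation` for `x ˘` and `z`, combined with monotonicity.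
  residual : ∀ {x y z} → y ≤ ¯ (x ˘ ⨾ z) → x ⨾ y ≤ ¯ z
  residual {x} {y} {z} p = ≤-trans
    (≤-respˡ-≈ (⨾-cong (˘-involutive x) ≈-refl) (⨾-monoʳ p))
    (residuation (x ˘) z)

  -- Peircean law: otherwise the atom `y` lies below the complement of `x ˘ ⨾ z`, and `residual`
  -- puts `z` below `¯ z`.
  cycleˡ : ∀ {x y z} → IsAtom y → IsAtom z → z ≤ x ⨾ y → y ≤ x ˘ ⨾ z
  cycleˡ atomʸ atomᶻ p =
    fromInj₁ (λ q → contradiction (≤-trans p (residual q)) (atom-irrefl atomᶻ))
      (atom-≤-or-≤¯ atomʸ _)

  ˘-antitone-⨾ : ∀ {x y z} → z ≤ x ⨾ y → z ˘ ≤ y ˘ ⨾ x ˘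
  ˘-antitone-⨾ p = ≤-respʳ-≈ (˘-antidistrib _ _) (˘-mono p)

  ˘-zero : 0# ˘ ≈ 0#
  ˘-zero = x≤0⇒x≈0 (≤-respʳ-≈ (˘-involutive 0#) (˘-mono (0≤x (0# ˘))))

  ˘-atom : ∀ {a} → IsAtom a → IsAtom (a ˘)
  ˘-atom {a} (a≉0 , minimal)
    = (λ e → a≉0 (≈-trans (≈-sym (˘-involutive a)) (≈-trans (˘-cong e) ˘-zero)))
    , λ y p → Sum.map
        (λ e → ≈-trans (≈-sym (˘-involutive y)) (≈-trans (˘-cong e) ˘-zero))
        (λ e → ≈-trans (≈-sym (˘-involutive y)) (˘-cong e))
        (minimal (y ˘) (≤-respʳ-≈ (˘-involutive a) (˘-mono p)))

  cycleʳ : ∀ {x y z} → IsAtom x → IsAtom z → z ≤ x ⨾ y → x ≤ z ⨾ y ˘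
  cycleʳ {x} {y} {z} atomˣ atomᶻ p = ≤-respˡ-≈ (˘-involutive x)
    (≤-respʳ-≈ (≈-trans (˘-antidistrib _ _) (⨾-cong (˘-involutive z) (˘-cong (˘-involutive y))))
      (˘-mono (cycleˡ (˘-atom atomˣ) (˘-atom atomᶻ) (˘-antitone-⨾ p))))

  -- Since `e ˘ ⨾ z` lies below `1′ ⨾ z`, it is `0#` or the atom `z`; if it were `0#`, `residual`
  -- would put `e ⨾ 1#` below `¯ z`.
  subidentity-⨾ : ∀ {e z} → e ≤ 1′ → IsAtom z → z ≤ e ⨾ 1# → z ≤ e ˘ ⨾ z
  subidentity-⨾ {e} {z} e≤1′ atomᶻ p =
    [ (λ e˘⨾z≈0 → contradiction
        (≤-trans p (residual (≤-respʳ-≈ (≈-sym (≈-trans (¯-cong e˘⨾z≈0) (¯-involutive 1#))) ≤-refl)))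
        (atom-irrefl atomᶻ))
    , (λ e˘⨾z≈z → ≤-reflexive (≈-sym e˘⨾z≈z))
    ]′ (proj₂ atomᶻ (e ˘ ⨾ z) (≤-respʳ-≈ (⨾-identityˡ z) (⨾-monoˡ (˘-subidentity e≤1′))))

  -- Weak associativity enters here only: z ≤ (e ⨾ 1) ⨾ 1 = e ⨾ 1.
  domain-⨾ : ∀ {e x y z} → e ≤ 1′ → IsAtom z → x ≤ e ⨾ x → z ≤ x ⨾ y → z ≤ e ⨾ z
  domain-⨾ {e} {x} {y} {z} e≤1′ atomᶻ p q =
    ≤-respʳ-≈ (⨾-cong (˘-involutive e) ≈-refl)
      (subidentity-⨾ (˘-subidentity e≤1′) atomᶻ
        (≤-trans (subidentity-⨾ e≤1′ atomᶻ z≤e⨾1) (⨾-monoʳ (x≤1 z))))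
    where
    e·1′≈e : e · 1′ ≈ e
    e·1′≈e = ≤-antisym (x·y≤x e 1′) (·-glb ≤-refl e≤1′)
    z≤e⨾1 : z ≤ e ⨾ 1#
    z≤e⨾1 = ≤-trans q (≤-respʳ-≈
      (≈-trans (⨾-cong (⨾-cong (≈-sym e·1′≈e) ≈-refl) ≈-refl)
        (≈-trans (⨾-weakAssoc e) (⨾-cong e·1′≈e ≈-refl)))
      (⨾-mono (≤-trans p (⨾-monoʳ (x≤1 x))) (x≤1 y)))

  subidentity-idem : ∀ {e} → IsAtom e → e ≤ 1′ → e ≤ e ⨾ e
  subidentity-idem {e} atomᵉ e≤1′ = ≤-respʳ-≈ (⨾-cong (˘-involutive e) ≈-refl)
    (subidentity-⨾ (˘-subidentity e≤1′) atomᵉ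
      (≤-trans (subidentity-⨾ e≤1′ atomᵉ e≤e⨾1) (⨾-monoʳ (x≤1 e))))
    where
    e≤e⨾1 : e ≤ e ⨾ 1#
    e≤e⨾1 = ≤-respˡ-≈ (⨾-identityʳ e) (⨾-monoʳ (x≤1 1′))

  ˘-subidentity-atom : ∀ {e} → IsAtom e → e ≤ 1′ → e ˘ ≈ e
  ˘-subidentity-atom {e} atomᵉ e≤1′ = ≈-sym (atoms-≤⇒≈ atomᵉ (˘-atom atomᵉ)
    (≤-respʳ-≈ (⨾-identityʳ (e ˘)) (≤-trans
      (cycleˡ atomᵉ atomᵉ (subidentity-idem atomᵉ e≤1′)) (⨾-monoʳ e≤1′))))

  -- The cycle law turns the first inequality into e ≤ a⨾a˘. As `f` fixes `a` on the left,
  -- `domain-⨾` gives e ≤ f⨾e, which lies below f⨾1′ = f.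
  domain-unique : ∀ {e f a} → IsAtom e → IsAtom f → IsAtom a → e ≤ 1′ → f ≤ 1′ →
                  a ≤ e ⨾ a → a ≤ f ⨾ a → e ≈ f
  domain-unique {e} {f} atomᵉ atomᶠ atomᵃ e≤1′ f≤1′ p q = atoms-≤⇒≈ atomᵉ atomᶠ
    (≤-respʳ-≈ (⨾-identityʳ f) (≤-trans
      (domain-⨾ f≤1′ atomᵉ q (cycleʳ atomᵉ atomᵃ p))
      (⨾-monoʳ e≤1′)))

  -- Splitting compositions at atoms.

  module Atomic (atomic : IsAtomic) (zero? : ∀ x → Dec (x ≈ 0#)) where

    atom-below : ∀ x → x ≈ 0# ⊎ ∃ λ a → IsAtom a × a ≤ x
    atom-below x with zero? x
    ... | yes x≈0 = inj₁ x≈0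
    ... | no  x≉0 = inj₂ (atomic x x≉0)

    -- Any atom below `y · (x ˘ ⨾ z)` serves, by the cycle law; that element is nonzero, since
    -- otherwise `residual` gives `x ⨾ y ≤ ¯ z`.
    splitʳ : ∀ {x y z} → IsAtom z → z ≤ x ⨾ y → ∃ λ b → IsAtom b × b ≤ y × z ≤ x ⨾ b
    splitʳ {x} {y} {z} atomᶻ p =
      [ (λ e → contradiction (≤-trans p (residual (x·y≈0⇒x≤¯y e))) (atom-irrefl atomᶻ))
      , (λ (b , atomᵇ , b≤) → b , atomᵇ , ≤-trans b≤ (x·y≤x _ _) ,
          ≤-respʳ-≈ (⨾-cong (˘-involutive x) ≈-refl)
            (cycleˡ atomᶻ atomᵇ (≤-trans b≤ (x·y≤y _ _))))
      ]′ (atom-below (y · (x ˘ ⨾ z)))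

    splitˡ : ∀ {x y z} → IsAtom z → z ≤ x ⨾ y → ∃ λ b → IsAtom b × b ≤ x × z ≤ b ⨾ y
    splitˡ {x} {y} atomᶻ p =
      let b , atomᵇ , b≤ , q = splitʳ (˘-atom atomᶻ) (˘-antitone-⨾ p) in
      b ˘ , ˘-atom atomᵇ , ≤-respʳ-≈ (˘-involutive x) (˘-mono b≤) ,
      ≤-respˡ-≈ (˘-involutive _) (≤-respʳ-≈ (⨾-cong ≈-refl (˘-involutive y)) (˘-antitone-⨾ q))

    atomwise-≤ : ∀ {x y} → (∀ a → IsAtom a → a ≤ x → a ≤ y) → x ≤ y
    atomwise-≤ {x} {y} f =
      [ (λ e → ≤-respʳ-≈ (¯-involutive y) (x·y≈0⇒x≤¯y e))
      , (λ (a , atomᵃ , a≤) → contradiction (≤-trans a≤ (x·y≤y _ _))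
          (atom-disjoint atomᵃ (f a atomᵃ (≤-trans a≤ (x·y≤x _ _)))))
      ]′ (atom-below (x · ¯ y))

-- Edge and vertex labels of triangles of atoms.

module Triangles (em : ∀ {p} → ExcludedMiddle p) {c ℓ} {𝔄 : RawRA c ℓ} (isWA : IsWA 𝔄)
                 (atomic : RawRA.IsAtomic 𝔄) where
  open RawRA 𝔄
  open IsWA isWA
  open IsEquivalence isEquivalence using () renaming (refl to ≈-refl; sym to ≈-sym; trans to ≈-trans)
  open WeaklyAssociative isWA
  open Atomic atomic (λ _ → em)
  open Suitable 𝔄 isEquivalence

  ∣_∣ : At → Carrier
  ∣_∣ = proj₁

  infix 8 _˘ᵃ
  _˘ᵃ : At → At
  (a , atom) ˘ᵃ = a ˘ , ˘-atom atom

  abstract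
    domain : ∀ (a : At) → ∃ λ (e : At) → ∣ e ∣ ≤ 1′ × ∣ a ∣ ≤ ∣ e ∣ ⨾ ∣ a ∣
    domain (a , atom) =
      let e , atomᵉ , e≤1′ , p = splitˡ atom (≤-reflexive (≈-sym (⨾-identityˡ a))) in
      (e , atomᵉ) , e≤1′ , p

  dom : At → At
  dom a = proj₁ (domain a)

  -- The triangle t has vertices 0, 1, 2, and its atom t $ κ labels the edge
  -- opposite to κ; label t i j is the atom of the edge directed from i to j.
  label : Triple → Fin 3 → Fin 3 → At
  label t 0F 0F = dom (atoms t 2F)
  label t 1F 1F = dom (atoms t 0F)
  label t 2F 2F = dom (atoms t 1F ˘ᵃ)
  label t 0F 1F = atoms t 2F
  label t 1F 0F = atoms t 2F ˘ᵃ
  label t 1F 2F = atoms t 0F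
  label t 2F 1F = atoms t 0F ˘ᵃ
  label t 0F 2F = atoms t 1F
  label t 2F 0F = atoms t 1F ˘ᵃ

  infix 9 _⟦_,_⟧
  _⟦_,_⟧ : Triple → Fin 3 → Fin 3 → Carrier
  t ⟦ i , j ⟧ = ∣ label t i j ∣

  label-atom : ∀ t i j → IsAtom (t ⟦ i , j ⟧)
  label-atom t i j = proj₂ (label t i j)

  label-diag : ∀ t i → t ⟦ i , i ⟧ ≤ 1′
  label-diag t 0F = proj₁ (proj₂ (domain _))
  label-diag t 1F = proj₁ (proj₂ (domain _))
  label-diag t 2F = proj₁ (proj₂ (domain _))

  label-˘ : ∀ t i j → t ⟦ j , i ⟧ ≈ t ⟦ i , j ⟧ ˘
  label-˘ t 0F 0F = ≈-sym (˘-subidentity-atom (label-atom t 0F 0F) (label-diag t 0F))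
  label-˘ t 1F 1F = ≈-sym (˘-subidentity-atom (label-atom t 1F 1F) (label-diag t 1F))
  label-˘ t 2F 2F = ≈-sym (˘-subidentity-atom (label-atom t 2F 2F) (label-diag t 2F))
  label-˘ t 0F 1F = ≈-refl
  label-˘ t 1F 0F = ≈-sym (˘-involutive _)
  label-˘ t 1F 2F = ≈-refl
  label-˘ t 2F 1F = ≈-sym (˘-involutive _)
  label-˘ t 0F 2F = ≈-refl
  label-˘ t 2F 0F = ≈-sym (˘-involutive _)

  private
    reverse : ∀ t i j k → t ⟦ i , k ⟧ ≤ t ⟦ i , j ⟧ ⨾ t ⟦ j , k ⟧ →
              t ⟦ k , i ⟧ ≤ t ⟦ k , j ⟧ ⨾ t ⟦ j , i ⟧
    reverse t i j k p = ≤-respˡ-≈ (≈-sym (label-˘ t i k))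
      (≤-respʳ-≈ (⨾-cong (≈-sym (label-˘ t j k)) (≈-sym (label-˘ t i j))) (˘-antitone-⨾ p))

    021-triangle : ∀ t → t ⟦ 0F , 1F ⟧ ≤ t ⟦ 0F , 2F ⟧ ⨾ t ⟦ 2F , 1F ⟧
    021-triangle t = cycleʳ (label-atom t 0F 1F) (label-atom t 0F 2F) (cycle t)

    102-triangle : ∀ t → t ⟦ 1F , 2F ⟧ ≤ t ⟦ 1F , 0F ⟧ ⨾ t ⟦ 0F , 2F ⟧
    102-triangle t = cycleˡ (label-atom t 1F 2F) (label-atom t 0F 2F) (cycle t)

    via : ∀ t i j k → t ⟦ i , k ⟧ ≤ t ⟦ i , j ⟧ ⨾ t ⟦ j , k ⟧ → t ⟦ i , j ⟧ ≤ t ⟦ i , i ⟧ ⨾ t ⟦ i , j ⟧ →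
          t ⟦ i , k ⟧ ≤ t ⟦ i , i ⟧ ⨾ t ⟦ i , k ⟧
    via t i j k p q = domain-⨾ (label-diag t i) (label-atom t i k) q p

  -- The label of a vertex is by definition the domain of one outgoing edge: 0 to 1, 1 to 2, or 2 to
  -- 0. Weak associativity, through `domain-⨾`, makes it the domain of the other outgoing edge too.
  label-domain : ∀ t i k → t ⟦ i , k ⟧ ≤ t ⟦ i , i ⟧ ⨾ t ⟦ i , k ⟧
  label-domain t 0F 0F = subidentity-idem (label-atom t 0F 0F) (label-diag t 0F)
  label-domain t 1F 1F = subidentity-idem (label-atom t 1F 1F) (label-diag t 1F)
  label-domain t 2F 2F = subidentity-idem (label-atom t 2F 2F) (label-diag t 2F)
  label-domain t 0F 1F = proj₂ (proj₂ (domain _))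
  label-domain t 1F 2F = proj₂ (proj₂ (domain _))
  label-domain t 2F 0F = proj₂ (proj₂ (domain _))
  label-domain t 0F 2F = via t 0F 1F 2F (cycle t) (label-domain t 0F 1F)
  label-domain t 1F 0F = via t 1F 2F 0F (reverse t 0F 2F 1F (021-triangle t)) (label-domain t 1F 2F)
  label-domain t 2F 1F = via t 2F 0F 1F (reverse t 1F 0F 2F (102-triangle t)) (label-domain t 2F 0F)

  private
    label-range : ∀ t i k → t ⟦ i , k ⟧ ≤ t ⟦ i , k ⟧ ⨾ t ⟦ k , k ⟧
    label-range t i k = reverse t k k i (label-domain t k i)

    label-loop : ∀ t i j → t ⟦ i , i ⟧ ≤ t ⟦ i , j ⟧ ⨾ t ⟦ j , i ⟧
    label-loop t i j = ≤-respʳ-≈ (⨾-cong ≈-refl (≈-sym (label-˘ t i j)))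
      (cycleʳ (label-atom t i i) (label-atom t i j) (label-domain t i j))

  -- The rotations and reversals of `cycle` cover distinct vertices. The cases with repeated
  -- vertices are included so that degenerate triangles can be built later.
  label-triangle : ∀ t i j k → t ⟦ i , k ⟧ ≤ t ⟦ i , j ⟧ ⨾ t ⟦ j , k ⟧
  label-triangle t 0F 0F k  = label-domain t 0F k
  label-triangle t 1F 1F k  = label-domain t 1F k
  label-triangle t 2F 2F k  = label-domain t 2F k
  label-triangle t 0F 1F 0F = label-loop t 0F 1F
  label-triangle t 0F 1F 1F = label-range t 0F 1F
  label-triangle t 0F 1F 2F = cycle t
  label-triangle t 0F 2F 0F = label-loop t 0F 2F
  label-triangle t 0F 2F 1F = 021-triangle t
  label-triangle t 0F 2F 2F = label-range t 0F 2F
  label-triangle t 1F 0F 0F = label-range t 1F 0F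
  label-triangle t 1F 0F 1F = label-loop t 1F 0F
  label-triangle t 1F 0F 2F = 102-triangle t
  label-triangle t 1F 2F 0F = reverse t 0F 2F 1F (021-triangle t)
  label-triangle t 1F 2F 1F = label-loop t 1F 2F
  label-triangle t 1F 2F 2F = label-range t 1F 2F
  label-triangle t 2F 0F 0F = label-range t 2F 0F
  label-triangle t 2F 0F 1F = reverse t 1F 0F 2F (102-triangle t)
  label-triangle t 2F 0F 2F = label-loop t 2F 0F
  label-triangle t 2F 1F 0F = reverse t 0F 1F 2F (cycle t)
  label-triangle t 2F 1F 1F = label-range t 2F 1F
  label-triangle t 2F 1F 2F = label-loop t 2F 1F

  private
    label-loop-local : ∀ s t i j → s ⟦ i , j ⟧ ≈ t ⟦ i , j ⟧ → s ⟦ i , i ⟧ ≈ t ⟦ i , i ⟧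
    label-loop-local s t i j e = domain-unique (label-atom s i i) (label-atom t i i)
      (label-atom s i j) (label-diag s i) (label-diag t i) (label-domain s i j)
      (≤-respˡ-≈ (≈-sym e) (≤-respʳ-≈ (⨾-cong ≈-refl (≈-sym e)) (label-domain t i j)))

  -- The label of a vertex may have been taken from an edge that `s` and `t` do not share; it is
  -- nevertheless the domain of the shared edge, and domains are unique.
  label-local : ∀ s t κ i j → i ≢ κ → j ≢ κ → s $ κ ≈ t $ κ → s ⟦ i , j ⟧ ≈ t ⟦ i , j ⟧
  label-local s t 0F 0F _ p q e = contradiction refl p
  label-local s t 1F 1F _ p q e = contradiction refl p
  label-local s t 2F 2F _ p q e = contradiction refl p
  label-local s t 0F _ 0F p q e = contradiction refl q
  label-local s t 1F _ 1F p q e = contradiction refl q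
  label-local s t 2F _ 2F p q e = contradiction refl q
  label-local s t 0F 1F 2F p q e = e
  label-local s t 0F 2F 1F p q e = ˘-cong e
  label-local s t 1F 0F 2F p q e = e
  label-local s t 1F 2F 0F p q e = ˘-cong e
  label-local s t 2F 0F 1F p q e = e
  label-local s t 2F 1F 0F p q e = ˘-cong e
  label-local s t 0F 1F 1F p q e = label-loop-local s t 1F 2F e
  label-local s t 0F 2F 2F p q e = label-loop-local s t 2F 1F (˘-cong e)
  label-local s t 1F 0F 0F p q e = label-loop-local s t 0F 2F e
  label-local s t 1F 2F 2F p q e = label-loop-local s t 2F 0F (˘-cong e)
  label-local s t 2F 0F 0F p q e = label-loop-local s t 0F 1F e
  label-local s t 2F 1F 1F p q e = label-loop-local s t 1F 0F (˘-cong e)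

  label-cong : ∀ s t i j → s ≈ᵇ t → s ⟦ i , j ⟧ ≈ t ⟦ i , j ⟧
  label-cong s t 0F 0F e = label-local s t 1F 0F 0F (λ ()) (λ ()) (e 1F)
  label-cong s t 0F 1F e = e 2F
  label-cong s t 0F 2F e = e 1F
  label-cong s t 1F 0F e = ˘-cong (e 2F)
  label-cong s t 1F 1F e = label-local s t 0F 1F 1F (λ ()) (λ ()) (e 0F)
  label-cong s t 1F 2F e = e 0F
  label-cong s t 2F 0F e = ˘-cong (e 1F)
  label-cong s t 2F 1F e = ˘-cong (e 0F)
  label-cong s t 2F 2F e = label-local s t 0F 2F 2F (λ ()) (λ ()) (e 0F)

  -- By the triangle law the left atom lies below `1′ ⨾ t ⟦ j , k ⟧`, hence below the right one.
  label-mergeˡ : ∀ t i j k → t ⟦ i , j ⟧ ≤ 1′ → t ⟦ i , k ⟧ ≈ t ⟦ j , k ⟧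
  label-mergeˡ t i j k p = atoms-≤⇒≈ (label-atom t i k) (label-atom t j k)
    (≤-respʳ-≈ (⨾-identityˡ _) (≤-trans (label-triangle t i j k) (⨾-monoˡ p)))

  label-mergeʳ : ∀ t i j k → t ⟦ j , k ⟧ ≤ 1′ → t ⟦ i , j ⟧ ≈ t ⟦ i , k ⟧
  label-mergeʳ t i j k p = ≈-sym (atoms-≤⇒≈ (label-atom t i k) (label-atom t i j)
    (≤-respʳ-≈ (⨾-identityʳ _) (≤-trans (label-triangle t i j k) (⨾-monoʳ p))))

  label-identity-trans : ∀ t i j k → t ⟦ i , j ⟧ ≤ 1′ → t ⟦ j , k ⟧ ≤ 1′ → t ⟦ i , k ⟧ ≤ 1′
  label-identity-trans t i j k p q = ≤-respˡ-≈ (≈-sym (label-mergeˡ t i j k p)) q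

  label-identity-sym : ∀ t i j → t ⟦ i , j ⟧ ≤ 1′ → t ⟦ j , i ⟧ ≤ 1′
  label-identity-sym t i j p = ≤-respˡ-≈ (≈-sym (label-˘ t i j)) (˘-subidentity p)

  Eᵇ⇒label-identity : ∀ t i j → Eᵇ t i j → t ⟦ i , j ⟧ ≤ 1′
  Eᵇ⇒label-identity t i .i diagonal = label-diag t i
  Eᵇ⇒label-identity t 0F 0F (offDiagonal _ i≢j _ _ _) = contradiction refl i≢j
  Eᵇ⇒label-identity t 1F 1F (offDiagonal _ i≢j _ _ _) = contradiction refl i≢j
  Eᵇ⇒label-identity t 2F 2F (offDiagonal _ i≢j _ _ _) = contradiction refl i≢j
  Eᵇ⇒label-identity t 0F j  (offDiagonal 0F _ μ≢i _ _) = contradiction refl μ≢i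
  Eᵇ⇒label-identity t 1F j  (offDiagonal 1F _ μ≢i _ _) = contradiction refl μ≢i
  Eᵇ⇒label-identity t 2F j  (offDiagonal 2F _ μ≢i _ _) = contradiction refl μ≢i
  Eᵇ⇒label-identity t i  0F (offDiagonal 0F _ _ μ≢j _) = contradiction refl μ≢j
  Eᵇ⇒label-identity t i  1F (offDiagonal 1F _ _ μ≢j _) = contradiction refl μ≢j
  Eᵇ⇒label-identity t i  2F (offDiagonal 2F _ _ μ≢j _) = contradiction refl μ≢j
  Eᵇ⇒label-identity t 0F 1F (offDiagonal 2F _ _ _ p) = p
  Eᵇ⇒label-identity t 1F 0F (offDiagonal 2F _ _ _ p) = ˘-subidentity p
  Eᵇ⇒label-identity t 0F 2F (offDiagonal 1F _ _ _ p) = p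
  Eᵇ⇒label-identity t 2F 0F (offDiagonal 1F _ _ _ p) = ˘-subidentity p
  Eᵇ⇒label-identity t 1F 2F (offDiagonal 0F _ _ _ p) = p
  Eᵇ⇒label-identity t 2F 1F (offDiagonal 0F _ _ _ p) = ˘-subidentity p

  label-identity⇒Eᵇ : ∀ t i j → t ⟦ i , j ⟧ ≤ 1′ → Eᵇ t i j
  label-identity⇒Eᵇ t 0F 0F p = diagonal
  label-identity⇒Eᵇ t 1F 1F p = diagonal
  label-identity⇒Eᵇ t 2F 2F p = diagonal
  label-identity⇒Eᵇ t 0F 1F p = offDiagonal 2F (λ ()) (λ ()) (λ ()) p
  label-identity⇒Eᵇ t 1F 0F p = offDiagonal 2F (λ ()) (λ ()) (λ ()) (label-identity-sym t 1F 0F p)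
  label-identity⇒Eᵇ t 0F 2F p = offDiagonal 1F (λ ()) (λ ()) (λ ()) p
  label-identity⇒Eᵇ t 2F 0F p = offDiagonal 1F (λ ()) (λ ()) (λ ()) (label-identity-sym t 2F 0F p)
  label-identity⇒Eᵇ t 1F 2F p = offDiagonal 0F (λ ()) (λ ()) (λ ()) p
  label-identity⇒Eᵇ t 2F 1F p = offDiagonal 0F (λ ()) (λ ()) (λ ()) (label-identity-sym t 2F 1F p)

  triangle : (a b c : At) → ∣ b ∣ ≤ ∣ c ∣ ⨾ ∣ a ∣ → Triple
  triangle a b c p = record { atoms = a Vector.∷ b Vector.∷ c Vector.∷ Vector.[] ; cycle = p }

-- Trails, their first triangles and swaps.

module Unfolding (em : ∀ {p} → ExcludedMiddle p) {c ℓ} {𝔄 : RawRA c ℓ} (isWA : IsWA 𝔄) where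
  open Representation em 𝔄 isWA
  open RawRA 𝔄 using (Carrier; _≈_)
  open Setoid 𝐔 public using ()
    renaming (refl to ≈ₜ-refl; sym to ≈ₜ-sym; trans to ≈ₜ-trans)
  open IsEquivalence (IsWA.isEquivalence isWA) using () renaming (refl to ≈-refl; sym to ≈-sym; trans to ≈-trans)

  private
    variable
      p q r : Trail
      f g h : Fin 3 → Carrier

  -- The laws of _≈ᵇ_, in a form from which f, g and h can be inferred.
  ≈ᵇ-refl : ∀ κ → f κ ≈ f κ
  ≈ᵇ-refl κ = ≈-refl

  ≈ᵇ-sym : (∀ κ → f κ ≈ g κ) → ∀ κ → g κ ≈ f κ
  ≈ᵇ-sym e κ = ≈-sym (e κ)

  ≈ᵇ-trans : (∀ κ → f κ ≈ g κ) → (∀ κ → g κ ≈ h κ) → ∀ κ → f κ ≈ h κ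
  ≈ᵇ-trans e e′ κ = ≈-trans (e κ) (e′ κ)

  infix 4 _≋ₑ_
  _≋ₑ_ : List ∣Entry∣ → List ∣Entry∣ → Set (c ⊔ ℓ)
  _≋ₑ_ = Pointwise (Setoid._≈_ Entry)

  ≋ₑ-refl : ∀ xs → xs ≋ₑ xs
  ≋ₑ-refl xs = Pointwise.refl (λ {x} → Setoid.refl Entry {x})

  entries-≈ₜ : entries p ≡ entries q → p ≈ₜ q
  entries-≈ₜ {p} e = Closure.return
    (same (subst (entries p ≋ₑ_) e (≋ₑ-refl (entries p))))

  root : Triple → Trail
  -- The index is a placeholder: `_⟨_⟩` overwrites it.
  root t = record { init = [] ; end = t ; index = 0F ; linked = [-] }

  root-cong : ∀ {s t} → s ≈ᵇ t → ∀ κ → root s ⟨ κ ⟩ ≈ₜ root t ⟨ κ ⟩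
  root-cong e κ = Closure.return (same ((e , refl) ∷ []))

  head : List ∣Entry∣ → Triple → Triple
  head []            t = t
  head ((s , _) ∷ _) _ = s

  start : Trail → Triple
  start p = head (init p) (end p)

  head-entry : ∀ xs t κ → ∃ λ ν → ∃ λ ys → xs ∷ʳ (t , κ) ≡ (head xs t , ν) ∷ ys
  head-entry []             t κ = κ , [] , refl
  head-entry ((s , ν) ∷ xs) t κ = ν , _ , refl

  start-entry : ∀ p → ∃ λ ν → ∃ λ ys → entries p ≡ (start p , ν) ∷ ys
  start-entry p = head-entry (init p) (end p) (index p)

  start-≡ : ∀ p {s ν ys} → entries p ≡ (s , ν) ∷ ys → start p ≡ s
  start-≡ p e with start-entry p
  ... | _ , _ , e′ with trans (sym e′) e
  ... | refl = refl

  -- No rule changes the first triangle, so a case distinction on it is compatible with the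
  -- identifications defining U.
  start-⟶ : p ⟶ q → start p ≈ᵇ start q
  start-⟶ {p} {q} (same pw) with start-entry p | start-entry q
  ... | _ , _ , e | _ , _ , e′ with subst (_ ≋ₑ_) e′ (subst (_≋ₑ entries q) e pw)
  ... | (s , _) ∷ _ = s
  start-⟶ {p} {q} (back []            t ν s κ ys e e′) rewrite start-≡ p e | start-≡ q e′ = ≈ᵇ-refl
  start-⟶ {p} {q} (back ((_ , _) ∷ _) t ν s κ ys e e′) rewrite start-≡ p e | start-≡ q e′ = ≈ᵇ-refl
  start-⟶ {p} {q} (drop []            t ν s μ _ e e′)  rewrite start-≡ p e | start-≡ q e′ = ≈ᵇ-refl
  start-⟶ {p} {q} (drop ((_ , _) ∷ _) t ν s μ _ e e′)  rewrite start-≡ p e | start-≡ q e′ = ≈ᵇ-refl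
  start-⟶ {p} {q} (turn []            t ν κ _ e e′)    rewrite start-≡ p e | start-≡ q e′ = ≈ᵇ-refl
  start-⟶ {p} {q} (turn ((_ , _) ∷ _) t ν κ _ e e′)    rewrite start-≡ p e | start-≡ q e′ = ≈ᵇ-refl

  -- Rules other than `same` act behind an arbitrary list `xs`, which absorbs the new entry.
  prefix-⟶ : ∀ {x p′ q′} → entries p′ ≡ x ∷ entries p → entries q′ ≡ x ∷ entries q → p ⟶ q → p′ ⟶ q′
  prefix-⟶ {p} {q} {x} {p′} {q′} a b (same pw) =
    same (subst (entries p′ ≋ₑ_) (sym b)
      (subst (_≋ₑ x ∷ entries q) (sym a) ((≈ᵇ-refl , refl) ∷ pw)))
  prefix-⟶ {x = x} a b (back xs t ν s κ ys e e′) =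
    back (x ∷ xs) t ν s κ ys (trans a (cong (x ∷_) e)) (trans b (cong (x ∷_) e′))
  prefix-⟶ {x = x} a b (drop xs t ν s μ ν≢μ e e′) =
    drop (x ∷ xs) t ν s μ ν≢μ (trans a (cong (x ∷_) e)) (trans b (cong (x ∷_) e′))
  prefix-⟶ {x = x} a b (turn xs t ν κ t∈E e e′) =
    turn (x ∷ xs) t ν κ t∈E (trans a (cong (x ∷_) e)) (trans b (cong (x ∷_) e′))

  link : ∀ {t κ s ν} xs → ¬ (t ≈ᵇ head xs s) → t $ κ ≈ head xs s $ κ →
         Linked Step (xs ∷ʳ (s , ν)) → Linked Step ((t , κ) ∷ xs ∷ʳ (s , ν))
  link []      t≉s tTs l = (t≉s , tTs) ∷ l
  link (_ ∷ _) t≉s tTs l = (t≉s , tTs) ∷ l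

  prepend : ∀ t κ p → ¬ (t ≈ᵇ start p) → t $ κ ≈ start p $ κ → Trail
  prepend t κ p t≉p tTp = record
    { init   = (t , κ) ∷ init p
    ; end    = end p
    ; index  = index p
    ; linked = link (init p) t≉p tTp (linked p)
    }

  -- Only the data of the trails are compared; their `linked` proofs are left out, as `_≈ₜ_` ignores
  -- them.
  record _≗_▹_ (q : Trail) (x : ∣Entry∣) (p : Trail) : Set (c ⊔ ℓ) where
    constructor prepended
    field
      init-≡  : init q ≡ x ∷ init p
      end-≡   : end q ≡ end p
      index-≡ : index q ≡ index p

    entries-≡ : entries q ≡ x ∷ entries p
    entries-≡ rewrite init-≡ | end-≡ | index-≡ = refl

    start-≡ᵖ : start q ≡ proj₁ x
    start-≡ᵖ = start-≡ q entries-≡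

  open _≗_▹_

  -- `back` asks for the two outer triangles to be literally equal, so s is
  -- first replaced by start p.
  cancel-prefix : ∀ {s κ t} → s ≈ᵇ start p → ¬ (t ≈ᵇ start p) → t $ κ ≈ start p $ κ →
                  q ≗ t , κ ▹ p → r ≗ s , κ ▹ q → r ≈ₜ p
  cancel-prefix {p} {q} {r} {s} {κ} {t} s≈p t≉p tTp q≡ r≡ = ≈ₜ-trans
    (Closure.return (same {q = r′} (subst (_≋ₑ entries r′) (sym (entries-≡ r≡))
      ((s≈p , refl) ∷ subst (_≋ₑ entries q′) (sym (entries-≡ q≡)) (≋ₑ-refl (entries q′))))))
    (Closure.return (back [] (start p) κ t _ _
      (cong (λ es → (start p , κ) ∷ (t , κ) ∷ es) (proj₂ (proj₂ (start-entry p))))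
      (proj₂ (proj₂ (start-entry p)))))
    where
    q′ r′ : Trail
    q′ = prepend t κ p t≉p tTp
    r′ = prepend (start p) κ q′ (t≉p ∘ ≈ᵇ-sym) (≈-sym tTp)

  -- The trails starting at s and those starting at t are exchanged by
  -- prefixing the edge between s and t; up to ≈ₜ this is an involution.
  module Swap (s : Triple) (κ : Fin 3) (t : Triple) (s≉t : ¬ (s ≈ᵇ t)) (sTt : s $ κ ≈ t $ κ) where

    -- The graph of the swap, so that its properties follow by cases on constructors instead of by
    -- unfolding decisions of `em`.
    data Swapped (p q : Trail) : Set (c ⊔ ℓ) where
      from-s : start p ≈ᵇ s → q ≗ t , κ ▹ p → Swapped p q
      from-t : start p ≈ᵇ t → q ≗ s , κ ▹ p → Swapped p q
      fixed  : ¬ (start p ≈ᵇ s) → ¬ (start p ≈ᵇ t) → q ≡ p → Swapped p q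

    swap : ∀ p → ∃ (Swapped p)
    swap p with em {P = start p ≈ᵇ s} | em {P = start p ≈ᵇ t}
    ... | yes e | _ = prepend t κ p (λ f → s≉t (≈ᵇ-trans (≈ᵇ-sym e) (≈ᵇ-sym f)))
      (≈-trans (≈-sym sTt) (≈-sym (e κ))) , from-s e (prepended refl refl refl)
    ... | no _ | yes e = prepend s κ p (λ f → s≉t (≈ᵇ-trans f e))
      (≈-trans sTt (≈-sym (e κ))) , from-t e (prepended refl refl refl)
    ... | no p≉s | no p≉t = p , fixed p≉s p≉t refl

    σ : Trail → Trail
    σ p = proj₁ (swap p)

    σ-swapped : ∀ p → Swapped p (σ p)
    σ-swapped p = proj₂ (swap p)

    Swapped-end : Swapped p q → end q ≡ end p
    Swapped-end (from-s _ e)   = end-≡ e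
    Swapped-end (from-t _ e)   = end-≡ e
    Swapped-end (fixed _ _ e)  = cong end e

    Swapped-⟨⟩ : ∀ ν → Swapped p q → Swapped (p ⟨ ν ⟩) (q ⟨ ν ⟩)
    Swapped-⟨⟩ ν (from-s e f)  = from-s e (prepended (init-≡ f) (end-≡ f) refl)
    Swapped-⟨⟩ ν (from-t e f)  = from-t e (prepended (init-≡ f) (end-≡ f) refl)
    Swapped-⟨⟩ ν (fixed e f g) = fixed e f (cong (_⟨ ν ⟩) g)

    Swapped-⟶ : ∀ {p′ q′} → p ⟶ q → Swapped p p′ → Swapped q q′ → p′ ⟶ q′
    Swapped-⟶ st (from-s _ a)     (from-s _ b)      = prefix-⟶ (entries-≡ a) (entries-≡ b) st
    Swapped-⟶ st (from-t _ a)     (from-t _ b)      = prefix-⟶ (entries-≡ a) (entries-≡ b) st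
    Swapped-⟶ st (fixed _ _ refl) (fixed _ _ refl)  = st
    Swapped-⟶ st (from-s e _)     (from-t f _)      =
      contradiction (≈ᵇ-trans (≈ᵇ-sym e) (≈ᵇ-trans (start-⟶ st) f)) s≉t
    Swapped-⟶ st (from-t e _)     (from-s f _)      =
      contradiction (≈ᵇ-trans (≈ᵇ-sym f) (≈ᵇ-trans (≈ᵇ-sym (start-⟶ st)) e)) s≉t
    Swapped-⟶ st (from-s e _)     (fixed f _ _)     =
      contradiction (≈ᵇ-trans (≈ᵇ-sym (start-⟶ st)) e) f
    Swapped-⟶ st (from-t e _)     (fixed _ f _)     =
      contradiction (≈ᵇ-trans (≈ᵇ-sym (start-⟶ st)) e) f
    Swapped-⟶ st (fixed f _ _)    (from-s e _)      = contradiction (≈ᵇ-trans (start-⟶ st) e) f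
    Swapped-⟶ st (fixed _ f _)    (from-t e _)      = contradiction (≈ᵇ-trans (start-⟶ st) e) f

    Swapped-functional : Swapped p q → Swapped p r → q ≈ₜ r
    Swapped-functional {p} a b =
      Closure.return (Swapped-⟶ {p} {p} (same (≋ₑ-refl (entries p))) a b)

    σ-cong : p ≈ₜ q → σ p ≈ₜ σ q
    σ-cong = Closure.gmap σ (λ st → Swapped-⟶ st (σ-swapped _) (σ-swapped _))

    σ-⟨⟩ : ∀ p ν → σ (p ⟨ ν ⟩) ≈ₜ σ p ⟨ ν ⟩
    σ-⟨⟩ p ν = Swapped-functional (σ-swapped (p ⟨ ν ⟩)) (Swapped-⟨⟩ ν (σ-swapped p))

    Swapped-involutive : Swapped p q → Swapped q r → r ≈ₜ p
    Swapped-involutive {p} {q} (from-s e a) (from-s f _) =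
      contradiction (≈ᵇ-sym (subst (_≈ᵇ s) (start-≡ᵖ a) f)) s≉t
    Swapped-involutive {p} {q} (from-s e a) (from-t f b) =
      cancel-prefix (≈ᵇ-sym e) (λ g → s≉t (≈ᵇ-trans (≈ᵇ-sym e) (≈ᵇ-sym g)))
        (≈-trans (≈-sym sTt) (≈-sym (e κ))) a b
    Swapped-involutive {p} {q} (from-s e a) (fixed _ f _) =
      contradiction (subst (_≈ᵇ t) (sym (start-≡ᵖ a)) ≈ᵇ-refl) f
    Swapped-involutive {p} {q} (from-t e a) (from-s f b) =
      cancel-prefix (≈ᵇ-sym e) (λ g → s≉t (≈ᵇ-trans g e))
        (≈-trans sTt (≈-sym (e κ))) a b
    Swapped-involutive {p} {q} (from-t e a) (from-t f _) =
      contradiction (subst (_≈ᵇ t) (start-≡ᵖ a) f) s≉t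
    Swapped-involutive {p} {q} (from-t e a) (fixed f _ _) =
      contradiction (subst (_≈ᵇ s) (sym (start-≡ᵖ a)) ≈ᵇ-refl) f
    Swapped-involutive (fixed e f refl) (from-s g _)     = contradiction g e
    Swapped-involutive (fixed e f refl) (from-t g _)     = contradiction g f
    Swapped-involutive (fixed e f refl) (fixed _ _ refl) = ≈ₜ-refl

    σ-involutive : ∀ p → σ (σ p) ≈ₜ p
    σ-involutive p = Swapped-involutive (σ-swapped p) (σ-swapped (σ p))

    -- Induction on the generation of `X`. A generator is preserved because a swap keeps the end of
    -- a trail, and complements because `σ` is an involution.
    generated-invariant : ∀ {X v} → ℭ X → v ∈ Mem X → (σ ∘ v) ∈ Mem X
    generated-invariant (gen t) (p , e , f) =
      σ p , subst (_≈ᵇ t) (sym (Swapped-end (σ-swapped p))) e ,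
      λ ν → ≈ₜ-trans (σ-cong (f ν)) (σ-⟨⟩ p ν)
    generated-invariant (ext (X⊆Y , Y⊆X) X∈) v∈ = X⊆Y (generated-invariant X∈ (Y⊆X v∈))
    generated-invariant (or X∈ Y∈) = Sum.map (generated-invariant X∈) (generated-invariant Y∈)
    generated-invariant {v = v} (not {X} X∈) v∉ σv∈ =
      v∉ (resp X (σ-involutive ∘ v) (generated-invariant X∈ σv∈))
    generated-invariant (cyl κ X∈) (w , w∈ , f) =
      σ ∘ w , generated-invariant X∈ w∈ , λ ν ν≢κ → σ-cong (f ν ν≢κ)
    generated-invariant (dia κ ν) = σ-cong
    generated-invariant (sup F F∈) (j , v∈) = j , generated-invariant (F∈ j) v∈

  -- Homogeneity: moving trails to their end triangle.

  triple : Trail → U³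
  triple p κ = p ⟨ κ ⟩

  -- The swap between the first two triangles of `whole` takes off its first entry; the inductions
  -- on the length of a trail use it as their step.
  module Tail (t : Triple) (κ : Fin 3) (xs : List ∣Entry∣) (s : Triple) (ν : Fin 3)
              (l : Linked Step ((t , κ) ∷ xs ∷ʳ (s , ν))) where

    tail : Trail
    tail = record { init = xs ; end = s ; index = ν ; linked = Linked.tail l }

    whole : Trail
    whole = record { init = (t , κ) ∷ xs ; end = s ; index = ν ; linked = l }

    first-step : Step (t , κ) (start tail , κ)
    first-step = go xs l
      where
      go : ∀ ys → Linked Step ((t , κ) ∷ ys ∷ʳ (s , ν)) → Step (t , κ) (head ys s , κ)
      go []      (st ∷ _) = st
      go (_ ∷ _) (st ∷ _) = st

    open Swap (start tail) κ t (proj₁ first-step ∘ ≈ᵇ-sym) (≈-sym (proj₂ first-step)) public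

    σ-tail : ∀ i → σ (tail ⟨ i ⟩) ≈ₜ whole ⟨ i ⟩
    σ-tail i = Swapped-functional (σ-swapped (tail ⟨ i ⟩)) (from-s ≈ᵇ-refl (prepended refl refl refl))

    σ-whole : ∀ i → σ (whole ⟨ i ⟩) ≈ₜ tail ⟨ i ⟩
    σ-whole i = ≈ₜ-trans (σ-cong (≈ₜ-sym (σ-tail i))) (σ-involutive (tail ⟨ i ⟩))

  generated-homogeneous : ∀ {X} → ℭ X → ∀ p →
    (triple p ∈ Mem X → triple (root (end p)) ∈ Mem X) ×
    (triple (root (end p)) ∈ Mem X → triple p ∈ Mem X)
  generated-homogeneous {X} X∈ p = go (init p) (linked p)
    where
    go : ∀ xs {s ν} (l : Linked Step (xs ∷ʳ (s , ν))) →
         let p = record { init = xs ; end = s ; index = ν ; linked = l } in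
         (triple p ∈ Mem X → triple (root s) ∈ Mem X) ×
         (triple (root s) ∈ Mem X → triple p ∈ Mem X)
    go []             l = resp X (λ κ → entries-≈ₜ refl) , resp X (λ κ → entries-≈ₜ refl)
    go ((t , κ) ∷ xs) l =
        (λ p∈ → proj₁ (go xs (Linked.tail l)) (resp X σ-whole (generated-invariant X∈ p∈)))
      , (λ r∈ → resp X σ-tail (generated-invariant X∈ (proj₂ (go xs (Linked.tail l)) r∈)))
      where open Tail t κ xs _ _ l

  R-nonempty : ∀ t → triple (root t) ∈ Mem (R t)
  R-nonempty t = root t , ≈ᵇ-refl , λ _ → ≈ₜ-refl

  R-minimal : ∀ t {X v} → ℭ X → v ∈ Mem (R t) → v ∈ Mem X → R t ⊑ X
  R-minimal t {X} X∈ (p , p-end , f) v∈ (q , q-end , g) = resp X (≈ₜ-sym ∘ g)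
    (proj₂ (generated-homogeneous X∈ q) (resp X
      (root-cong (≈ᵇ-trans p-end (≈ᵇ-sym q-end)))
      (proj₁ (generated-homogeneous X∈ p) (resp X f v∈))))

  -- The swaps that shorten `p` to a single triangle are applied to `q` as well. They respect `_≈ₜ_`
  -- and keep the end of `q`, so all coincidences of vertices survive at once.
  reroot : ∀ p q → ∃ λ q′ → end q′ ≡ end q ×
           (∀ i j → p ⟨ i ⟩ ≈ₜ q ⟨ j ⟩ → root (end p) ⟨ i ⟩ ≈ₜ q′ ⟨ j ⟩)
  reroot p = go (init p) (linked p)
    where
    go : ∀ xs {s ν} (l : Linked Step (xs ∷ʳ (s , ν))) q → ∃ λ q′ → end q′ ≡ end q ×
         (∀ i j → record { init = xs ; end = s ; index = ν ; linked = l } ⟨ i ⟩ ≈ₜ q ⟨ j ⟩ →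
                  root s ⟨ i ⟩ ≈ₜ q′ ⟨ j ⟩)
    go []             l q = q , refl , λ i j → ≈ₜ-trans (entries-≈ₜ refl)
    go ((t , κ) ∷ xs) l q =
      let q′ , end-≡ , f = go xs (Linked.tail l) (σ q) in
      q′ , trans end-≡ (Swapped-end (σ-swapped q)) , λ i j e →
        f i j (≈ₜ-trans (≈ₜ-sym (σ-whole i)) (≈ₜ-trans (σ-cong e) (σ-⟨⟩ q j)))
      where open Tail t κ xs _ _ l

-- Reduced histories and surviving vertices.

module Connection (em : ∀ {p} → ExcludedMiddle p) {c ℓ} {𝔄 : RawRA c ℓ} (isWA : IsWA 𝔄)
                  (atomic : RawRA.IsAtomic 𝔄) where
  open RawRA 𝔄 using (_≈_; _≤_; 1′)
  open IsEquivalence (IsWA.isEquivalence isWA) using ()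
    renaming (refl to ≈-refl; sym to ≈-sym; trans to ≈-trans)
  open WeaklyAssociative isWA
  open Representation em 𝔄 isWA
  open Triangles em isWA atomic
  open Unfolding em isWA

  private
    variable
      s t : Triple

  -- A history is the list of the moves (s , κ) made so far, latest first; a
  -- move through κ back to the triangle before the latest one undoes it.
  Undoes : List ∣Entry∣ → Fin 3 → Triple → Set ℓ
  Undoes []             κ t = ⊥
  Undoes ((s , ν) ∷ S) κ t = ν ≡ κ × s ≈ᵇ t

  Reduced : Triple → List ∣Entry∣ → Set ℓ
  Reduced t []            = ⊤
  Reduced t ((s , κ) ∷ S) = Reduced s S × ¬ Undoes S κ t

  Undoes-resp : ∀ S {κ} → s ≈ᵇ t → Undoes S κ s → Undoes S κ t
  Undoes-resp (_ ∷ _) e (ν≡κ , f) = ν≡κ , ≈ᵇ-trans f e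

  Reduced-resp : ∀ S → s ≈ᵇ t → Reduced s S → Reduced t S
  Reduced-resp []            e _       = tt
  Reduced-resp ((_ , _) ∷ S) e (r , n) = r , n ∘ Undoes-resp S (≈ᵇ-sym e)

  pop : List ∣Entry∣ → List ∣Entry∣
  pop []      = []
  pop (_ ∷ S) = S

  push : List ∣Entry∣ → ∣Entry∣ → Triple → List ∣Entry∣
  push S (t , κ) s with em {P = Undoes S κ s}
  ... | yes _ = pop S
  ... | no  _ = (t , κ) ∷ S

  push-undo : ∀ S t κ s → Undoes S κ s → push S (t , κ) s ≡ pop S
  push-undo S t κ s u with em {P = Undoes S κ s}
  ... | yes _ = refl
  ... | no ¬u = contradiction u ¬u

  push-new : ∀ S t κ s → ¬ Undoes S κ s → push S (t , κ) s ≡ (t , κ) ∷ S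
  push-new S t κ s ¬u with em {P = Undoes S κ s}
  ... | yes u = contradiction u ¬u
  ... | no _  = refl

  push-reduced : ∀ S t κ s → Reduced t S → Reduced s (push S (t , κ) s)
  push-reduced S t κ s r with em {P = Undoes S κ s}
  push-reduced S                t κ s r       | no ¬u = r , ¬u
  push-reduced ((_ , _) ∷ S) t κ s (r , _) | yes (_ , e) = Reduced-resp S e r

  -- If the first move is recorded, the second undoes it. If the first undoes the latest move of
  -- `S`, reducedness forbids a further cancellation, so the second restores that move.
  push-back : ∀ S t κ s → Reduced t S → push (push S (t , κ) s) (s , κ) t ≋ₑ S
  push-back S t κ s r with em {P = Undoes S κ s}
  push-back S t κ s r | no _ =
    subst (_≋ₑ S) (sym (push-undo ((t , κ) ∷ S) s κ t (refl , ≈ᵇ-refl))) (≋ₑ-refl S)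
  push-back ((s′ , .κ) ∷ S) t κ s (_ , n) | yes (refl , e) =
    subst (_≋ₑ (s′ , κ) ∷ S) (sym (push-new S s κ t n)) ((≈ᵇ-sym e , refl) ∷ ≋ₑ-refl S)

  Undoes-≋ₑ : ∀ {S S′ κ} → S ≋ₑ S′ → s ≈ᵇ t → Undoes S κ s → Undoes S′ κ t
  Undoes-≋ₑ ((a , b) ∷ _) e (ν≡κ , f) = trans (sym b) ν≡κ , ≈ᵇ-trans (≈ᵇ-sym a) (≈ᵇ-trans f e)

  ≋ₑ-sym : ∀ {xs ys} → xs ≋ₑ ys → ys ≋ₑ xs
  ≋ₑ-sym = Pointwise.symmetric λ (e , f) → ≈ᵇ-sym e , sym f

  push-≋ₑ : ∀ {S S′ t t′ κ s s′} → S ≋ₑ S′ → t ≈ᵇ t′ → s ≈ᵇ s′ → push S (t , κ) s ≋ₑ push S′ (t′ , κ) s′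
  push-≋ₑ {S} {S′} {κ = κ} {s} {s′} S≋ e f with em {P = Undoes S κ s} | em {P = Undoes S′ κ s′}
  push-≋ₑ (_ ∷ S≋) e f | yes _ | yes _ = S≋
  push-≋ₑ S≋       e f | no _  | no _  = (e , refl) ∷ S≋
  push-≋ₑ S≋       e f | yes u | no ¬u = contradiction (Undoes-≋ₑ S≋ f u) ¬u
  push-≋ₑ S≋       e f | no ¬u | yes u = contradiction (Undoes-≋ₑ (≋ₑ-sym S≋) (≈ᵇ-sym f) u) ¬u

  module From (ρ : Triple) where

    -- Carried κ S t i: along the history S, which leads from the triangle ρ
    -- to t, the vertex κ of ρ survives as the vertex i of t.
    Carried : Fin 3 → List ∣Entry∣ → Triple → Fin 3 → Set ℓ
    Carried κ []            t i = ρ ≈ᵇ t × t ⟦ κ , i ⟧ ≤ 1′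
    Carried κ ((s , ν) ∷ S) t i =
      s $ ν ≈ t $ ν × ∃ λ j → j ≢ ν × Carried κ S s j × t ⟦ j , i ⟧ ≤ 1′

    -- At each move both surviving vertices lie on the shared edge, whose labels agree in the two
    -- triangles; passing to a vertex joined by a subidentity atom changes no label.
    Carried-label : ∀ {κ κ′ i i′} S t → Carried κ S t i → Carried κ′ S t i′ →
                    ρ ⟦ κ , κ′ ⟧ ≈ t ⟦ i , i′ ⟧
    Carried-label {κ} {κ′} {i} {i′} [] t (e , p) (_ , q) =
      ≈-trans (label-cong ρ t κ κ′ e)
        (≈-trans (label-mergeˡ t κ i κ′ p) (label-mergeʳ t i κ′ i′ q))
    Carried-label {i = i} {i′} ((s , ν) ∷ S) t (e , j , j≢ν , p , q) (_ , j′ , j′≢ν , p′ , q′) =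
      ≈-trans (Carried-label S s p p′) (≈-trans (label-local s t ν j j′ j≢ν j′≢ν e)
        (≈-trans (label-mergeˡ t j i j′ q) (label-mergeʳ t i j′ i′ q′)))

    module _ (κ₀ : Fin 3) where

      Carried-turn : ∀ S {i j} → t ⟦ i , j ⟧ ≤ 1′ → Carried κ₀ S t i → Carried κ₀ S t j
      Carried-turn {t} []      {i} {j} p (e , q) = e , label-identity-trans t κ₀ i j q p
      Carried-turn {t} (_ ∷ S) {i} {j} p (e , k , k≢ν , r , q) =
        e , k , k≢ν , r , label-identity-trans t k i j q p

      Carried-≋ₑ : ∀ {S S′ i} → S ≋ₑ S′ → s ≈ᵇ t → Carried κ₀ S s i → Carried κ₀ S′ t i
      Carried-≋ₑ {s} {t} {i = i} [] e (f , p) =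
        ≈ᵇ-trans f e , ≤-respˡ-≈ (label-cong s t κ₀ i e) p
      Carried-≋ₑ {s} {t} {i = i} (_∷_ {x = _ , ν} (a , refl) S≋) e (f , j , j≢ν , r , p) =
        ≈-trans (≈-sym (a ν)) (≈-trans f (e ν)) , j , j≢ν , Carried-≋ₑ S≋ a r ,
        ≤-respˡ-≈ (label-cong s t j i e) p

      Carried-drop : ∀ S {s t ν i} → s $ ν ≈ t $ ν → ν ≢ i →
                     Carried κ₀ ((s , ν) ∷ S) t i → Carried κ₀ S s i
      Carried-drop S {s} {t} {ν} {i} e ν≢i (_ , j , j≢ν , r , p) =
        Carried-turn S (≤-respˡ-≈ (≈-sym (label-local s t ν j i j≢ν (ν≢i ∘ sym) e)) p) r

      Carried-extend : ∀ S {s t ν i} → s $ ν ≈ t $ ν → ν ≢ i →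
                       Carried κ₀ S s i → Carried κ₀ ((s , ν) ∷ S) t i
      Carried-extend S {t = t} {i = i} e ν≢i r = e , i , ν≢i ∘ sym , r , label-diag t i

      -- A move through `ν` keeps every vertex other than `ν`. When the move undoes the latest one,
      -- the history gets shorter, and dropping and extending exchange their roles.
      Carried-push : ∀ S {s t ν i} → s $ ν ≈ t $ ν → ν ≢ i →
                     Carried κ₀ (push S (s , ν) t) t i ⇔ Carried κ₀ S s i
      Carried-push S {s} {t} {ν} {i} e ν≢i with em {P = Undoes S ν t}
      Carried-push S e ν≢i | no _ = mk⇔ (Carried-drop S e ν≢i) (Carried-extend S e ν≢i)
      Carried-push ((s′ , _) ∷ S) {ν = ν} e ν≢i | yes (refl , f) = mk⇔
        (Carried-extend S s′Ts ν≢i ∘ Carried-≋ₑ (≋ₑ-refl S) (≈ᵇ-sym f))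
        (Carried-≋ₑ (≋ₑ-refl S) f ∘ Carried-drop S s′Ts ν≢i)
        where s′Ts = ≈-trans (f ν) (≈-sym e)

      -- Reads a trail from left to right while updating the history: all indices but the last are
      -- moves, and the last one names a vertex. The empty list is a default, as `entries` is never
      -- empty.
      Reached : List ∣Entry∣ → List ∣Entry∣ → Set ℓ
      Reached S []                           = ⊥
      Reached S ((t , i) ∷ [])               = Carried κ₀ S t i
      Reached S ((t , ν) ∷ es@((s , _) ∷ _)) = Reached (push S (t , ν) s) es

      Reached-≋ₑ : ∀ {S S′ es es′} → S ≋ₑ S′ → es ≋ₑ es′ → Reached S es → Reached S′ es′
      Reached-≋ₑ S≋ ((e , refl) ∷ []) r = Carried-≋ₑ S≋ e r
      Reached-≋ₑ S≋ ((e , refl) ∷ (f , refl) ∷ es≋) r =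
        Reached-≋ₑ (push-≋ₑ S≋ e f) ((f , refl) ∷ es≋) r

      -- Reading `xs` keeps the history reduced, so a rule acting behind `xs` has to be checked on
      -- reduced histories only.
      Reached-prefix : ∀ xs {t κ κ′ es es′} →
        (∀ S → Reduced t S → Reached S ((t , κ) ∷ es) ⇔ Reached S ((t , κ′) ∷ es′)) →
        ∀ S → Reduced (head xs t) S →
        Reached S (xs ++ (t , κ) ∷ es) ⇔ Reached S (xs ++ (t , κ′) ∷ es′)
      Reached-prefix [] f S r = f S r
      Reached-prefix ((s , ν) ∷ []) {t} f S r = f (push S (s , ν) t) (push-reduced S s ν t r)
      Reached-prefix ((s , ν) ∷ xs@((s′ , _) ∷ _)) f S r =
        Reached-prefix xs f (push S (s , ν) s′) (push-reduced S s ν s′ r)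

      linked-step : ∀ xs {t ν s μ} → Linked Step (xs ++ (t , ν) ∷ (s , μ) ∷ []) → t $ ν ≈ s $ ν
      linked-step []           ((_ , e) ∷ _) = e
      linked-step (_ ∷ [])     (_ ∷ l)       = linked-step [] l
      linked-step (_ ∷ x ∷ xs) (_ ∷ l)       = linked-step (x ∷ xs) l

      Reached-⟶ : ∀ p q → p ⟶ q → Reached [] (entries p) ⇔ Reached [] (entries q)
      Reached-⟶ p q (same es≋) = mk⇔ (Reached-≋ₑ [] es≋) (Reached-≋ₑ [] (≋ₑ-sym es≋))
      Reached-⟶ p q (back xs t ν s κ ys e e′) rewrite e | e′ =
        Reached-prefix xs (λ S r → unspike S r ys) [] tt
        where
        unspike : ∀ S → Reduced t S → ∀ ys →
                  Reached S ((t , ν) ∷ (s , ν) ∷ (t , κ) ∷ ys) ⇔ Reached S ((t , κ) ∷ ys)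
        unspike S r ys = mk⇔
          (Reached-≋ₑ (push-back S t ν s r) (≋ₑ-refl ((t , κ) ∷ ys)))
          (Reached-≋ₑ (≋ₑ-sym (push-back S t ν s r)) (≋ₑ-refl ((t , κ) ∷ ys)))
      Reached-⟶ p q (drop xs t ν s μ ν≢μ e e′)
        with linked-step xs (subst (Linked Step) e (linked p))
      ... | tTs rewrite e | e′ = Reached-prefix xs (λ S _ → Carried-push S tTs ν≢μ) [] tt
      Reached-⟶ p q (turn xs t ν κ t∈E e e′) rewrite e | e′ =
        Reached-prefix xs (λ S _ → mk⇔ (Carried-turn S ν≡κ)
          (Carried-turn S (label-identity-sym t ν κ ν≡κ))) [] tt
        where
        ν≡κ : t ⟦ ν , κ ⟧ ≤ 1′
        ν≡κ = Eᵇ⇒label-identity t ν κ t∈E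

      Reached-≈ₜ : ∀ {p q} → p ≈ₜ q → Reached [] (entries p) ⇔ Reached [] (entries q)
      Reached-≈ₜ = Closure.gfold ⇔-isEquivalence (Reached [] ∘ entries) (Reached-⟶ _ _)

    history : List ∣Entry∣ → List ∣Entry∣ → Triple → List ∣Entry∣
    history S []             t = S
    history S ((s , ν) ∷ xs) t = history (push S (s , ν) (head xs t)) xs t

    Reached⇒Carried : ∀ {κ} S xs {t i} → Reached κ S (xs ∷ʳ (t , i)) → Carried κ (history S xs t) t i
    Reached⇒Carried S []                         r = r
    Reached⇒Carried S ((s , ν) ∷ [])             r = r
    Reached⇒Carried S ((s , ν) ∷ (s′ , κ) ∷ xs) r = Reached⇒Carried (push S (s , ν) s′) ((s′ , κ) ∷ xs) r

    ≈ₜ⇒Carried : ∀ q {κ i} → root ρ ⟨ κ ⟩ ≈ₜ q ⟨ i ⟩ → Carried κ (history [] (init q) (end q)) (end q) i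
    ≈ₜ⇒Carried q {κ} e = Reached⇒Carried [] (init q)
      (Equivalence.to (Reached-≈ₜ κ e) (≈ᵇ-refl , label-diag ρ κ))

  -- After rerooting, both vertices survive along the history of the same trail, which does not
  -- depend on its final index, so `Carried-label` compares the two edges.
  ≈ₜ⇒label : ∀ p q {i i′ j j′} → p ⟨ i ⟩ ≈ₜ q ⟨ j ⟩ → p ⟨ i′ ⟩ ≈ₜ q ⟨ j′ ⟩ →
             end p ⟦ i , i′ ⟧ ≈ end q ⟦ j , j′ ⟧
  ≈ₜ⇒label p q {i} {i′} {j} {j′} e e′ =
    let q′ , end≡ , f = reroot p q in
    subst (λ t → end p ⟦ i , i′ ⟧ ≈ t ⟦ j , j′ ⟧) end≡
      (From.Carried-label (end p) _ (end q′)
        (From.≈ₜ⇒Carried (end p) q′ (f i j e)) (From.≈ₜ⇒Carried (end p) q′ (f i′ j′ e′)))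

  label⇒≈ₜ : ∀ p i j → end p ⟦ i , j ⟧ ≤ 1′ → p ⟨ i ⟩ ≈ₜ p ⟨ j ⟩
  label⇒≈ₜ p i j e = Closure.return
    (turn (init p) (end p) i j (label-identity⇒Eᵇ (end p) i j e) refl refl)

  ≈ₜ⇒label-identity : ∀ p i j → p ⟨ i ⟩ ≈ₜ p ⟨ j ⟩ → end p ⟦ i , j ⟧ ≤ 1′
  ≈ₜ⇒label-identity p i j e =
    ≤-respˡ-≈ (≈-sym (≈ₜ⇒label p p {i} {j} {j} {j} e ≈ₜ-refl)) (label-diag (end p) j)

  -- Appending `t` keeps the vertices other than `κ`, by `drop`. If `t` is already the end, nothing
  -- may be appended, since consecutive triangles must differ.
  step-to : ∀ p κ t → end p $ κ ≈ t $ κ → ∃ λ q → end q ≈ᵇ t × (∀ i → i ≢ κ → q ⟨ i ⟩ ≈ₜ p ⟨ i ⟩)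
  step-to p κ t pTt with em {P = end p ≈ᵇ t}
  ... | yes e = p , e , λ _ _ → ≈ₜ-refl
  ... | no ¬e = q , ≈ᵇ-refl , λ i i≢κ → Closure.return
      (drop (init p) (end p) κ t i (i≢κ ∘ sym) (snoc² (init p)) refl)
    where
    snoc² : ∀ xs {x y : ∣Entry∣} → (xs ∷ʳ x) ∷ʳ y ≡ xs ++ x ∷ y ∷ []
    snoc² []       = refl
    snoc² (x ∷ xs) = cong (x ∷_) (snoc² xs)
    extend : ∀ xs {ν} → Linked Step (xs ∷ʳ (end p , ν)) →
             Linked Step ((xs ∷ʳ (end p , κ)) ∷ʳ (t , 0F))
    extend []           _       = (¬e , pTt) ∷ [-]
    extend (x ∷ [])     (s ∷ l) = s ∷ extend [] l
    extend (x ∷ y ∷ xs) (s ∷ l) = s ∷ extend (y ∷ xs) l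
    q : Trail
    q = record { init = init p ∷ʳ (end p , κ) ; end = t ; index = 0F
               ; linked = extend (init p) (linked p) }

-- The representation and its homomorphism laws.

module RepresentationTheorem (em : ∀ {p} → ExcludedMiddle p) {c ℓ} {𝔄 : RawRA c ℓ} (isWA : IsWA 𝔄)
                             (complete : RawRA.IsComplete 𝔄) (atomic : RawRA.IsAtomic 𝔄) where
  open RawRA 𝔄
  open IsWA isWA
  open IsEquivalence isEquivalence using ()
    renaming (refl to ≈-refl; sym to ≈-sym; trans to ≈-trans)
  open WeaklyAssociative isWA
  open Atomic atomic (λ _ → em)
  open Representation em 𝔄 isWA
  open Triangles em isWA atomic
  open Unfolding em isWA
  open Connection em isWA atomic
  module Rl = RawCA₃ Rl
  module RaRl = RawRA (Ra Rl hasNr₂)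

  face : Triple → Fin 3 → Fin 3 → Fin 3 → Triple
  face t i j k = triangle (label t j k) (label t i k) (label t i j) (label-triangle t i j k)

  -- One step through `κ` leads to the degenerate face of `end p` in which vertex `κ` repeats vertex
  -- `i`. This supplies the points of `V` on the diagonals.
  copy : ∀ p κ i → κ ≢ i → ∃ λ q → q ⟨ κ ⟩ ≈ₜ p ⟨ i ⟩ × (∀ j → j ≢ κ → q ⟨ j ⟩ ≈ₜ p ⟨ j ⟩)
  copy p = go
    where
    t = end p

    via : ∀ κ i s → κ ≢ i → end p $ κ ≈ s $ κ → s ⟦ κ , i ⟧ ≤ 1′ →
          ∃ λ q → q ⟨ κ ⟩ ≈ₜ p ⟨ i ⟩ × (∀ j → j ≢ κ → q ⟨ j ⟩ ≈ₜ p ⟨ j ⟩)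
    via κ i s κ≢i pTs κ≡i =
      let q , q-end , f = step-to p κ s pTs in
      q , ≈ₜ-trans (label⇒≈ₜ q κ i (≤-respˡ-≈ (≈-sym (label-cong (end q) s κ i q-end)) κ≡i))
                   (f i (κ≢i ∘ sym)) , f

    go : ∀ κ i → κ ≢ i → ∃ λ q → q ⟨ κ ⟩ ≈ₜ p ⟨ i ⟩ × (∀ j → j ≢ κ → q ⟨ j ⟩ ≈ₜ p ⟨ j ⟩)
    go 0F 1F κ≢i = via 0F 1F (face t 1F 1F 2F) κ≢i ≈-refl (label-diag t 1F)
    go 0F 2F κ≢i = via 0F 2F (face t 2F 1F 2F) κ≢i ≈-refl (label-diag t 2F)
    go 1F 0F κ≢i = via 1F 0F (face t 0F 0F 2F) κ≢i ≈-refl (˘-subidentity (label-diag t 0F))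
    go 1F 2F κ≢i = via 1F 2F (face t 0F 2F 2F) κ≢i ≈-refl (label-diag t 2F)
    go 2F 0F κ≢i = via 2F 0F (face t 0F 1F 0F) κ≢i ≈-refl (˘-subidentity (label-diag t 0F))
    go 2F 1F κ≢i = via 2F 1F (face t 0F 1F 1F) κ≢i ≈-refl (˘-subidentity (label-diag t 1F))
    go 0F 0F κ≢i = contradiction refl κ≢i
    go 1F 1F κ≢i = contradiction refl κ≢i
    go 2F 2F κ≢i = contradiction refl κ≢i

  triple∈V : ∀ p → triple p ∈ Mem V
  triple∈V p = end p , p , ≈ᵇ-refl , λ _ → ≈ₜ-refl

  ·⁻ : ∀ X Y {v} → v ∈ Mem (set (X Rl.· Y)) → v ∈ Mem (set X) × v ∈ Mem (set Y)
  ·⁻ X Y (v∈V , n) = decidable-stable em (λ v∉X → n (inj₁ (v∈V , v∉X)))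
                   , decidable-stable em (λ v∉Y → n (inj₂ (v∈V , v∉Y)))

  ·⁺ : ∀ X Y {v} → v ∈ Mem (set X) → v ∈ Mem (set Y) → v ∈ Mem (set (X Rl.· Y))
  ·⁺ X Y v∈X v∈Y = ⊑V X v∈X , [ (λ (_ , v∉X) → v∉X v∈X) , (λ (_ , v∉Y) → v∉Y v∈Y) ]′

  rep : Carrier → RlSet
  rep x = record
    { set = ⋃ₛ (∃ λ t → t $ 2F ≤ x) (R ∘ proj₁)
    ; ∈S  = sup _ (gen ∘ proj₁)
    ; ⊑V  = λ ((t , _) , v∈R) → t , v∈R
    }

  rep⁺ : ∀ {x v} p → (∀ κ → v κ ≈ₜ p ⟨ κ ⟩) → end p $ 2F ≤ x → v ∈ Mem (set (rep x))
  rep⁺ p f p≤x = (end p , p≤x) , p , ≈ᵇ-refl , f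

  rep⁻ : ∀ {x v} p → (∀ κ → v κ ≈ₜ p ⟨ κ ⟩) → v ∈ Mem (set (rep x)) → end p $ 2F ≤ x
  rep⁻ p f ((t , t≤x) , q , q-end , g) = ≤-respˡ-≈
    (≈-sym (≈-trans (≈ₜ⇒label p q {0F} {1F} {0F} {1F} (p≈q 0F) (p≈q 1F)) (q-end 2F))) t≤x
    where
    p≈q : ∀ κ → p ⟨ κ ⟩ ≈ₜ q ⟨ κ ⟩
    p≈q κ = ≈ₜ-trans (≈ₜ-sym (f κ)) (g κ)

  -- Membership in `rep x` is a condition on the edge between the first two coordinates, and any
  -- trail through these two points sees the same atom there.
  rep-label : ∀ {x v} q i j → v ∈ Mem (set (rep x)) → q ⟨ i ⟩ ≈ₜ v 0F → q ⟨ j ⟩ ≈ₜ v 1F →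
              end q ⟦ i , j ⟧ ≤ x
  rep-label q i j ((t , t≤x) , r , r-end , f) e e′ = ≤-respˡ-≈
    (≈-sym (≈-trans (≈ₜ⇒label q r {i} {j} {0F} {1F} (≈ₜ-trans e (f 0F)) (≈ₜ-trans e′ (f 1F)))
      (r-end 2F))) t≤x

  rep-Nr₂ : ∀ x → Rl.Nr₂ (rep x)
  rep-Nr₂ x
    = (λ ((_ , p , _ , f) , w , w∈ , g) → rep⁺ p f (rep-label p 0F 1F w∈
        (≈ₜ-sym (≈ₜ-trans (g 0F λ ()) (f 0F))) (≈ₜ-sym (≈ₜ-trans (g 1F λ ()) (f 1F)))))
    , (λ v∈ → ⊑V (rep x) v∈ , _ , v∈ , λ _ _ → ≈ₜ-refl)

  rep-mono : ∀ {x y} → x ≤ y → set (rep x) ⊑ set (rep y)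
  rep-mono x≤y ((t , t≤x) , v∈R) = (t , ≤-trans t≤x x≤y) , v∈R


  rep-reflects-≤ : ∀ {x y} → set (rep x) ⊑ set (rep y) → x ≤ y
  rep-reflects-≤ {x} {y} x⊑y = atomwise-≤ λ a atom a≤x →
    -- A triangle with `a` on its edge 01: vertices 1 and 2 coincide, and `e`, the domain of `a ˘`,
    -- labels the edge between them.
    let e , e≤1′ , p = domain ((a , atom) ˘ᵃ)
        t = triangle e (a , atom) (a , atom)
              (≤-respˡ-≈ (˘-involutive a) (≤-respʳ-≈
                (⨾-cong (˘-involutive a) (˘-subidentity-atom (proj₂ e) e≤1′)) (˘-antitone-⨾ p)))
    in rep⁻ (root t) (λ _ → ≈ₜ-refl) (x⊑y (rep⁺ (root t) (λ _ → ≈ₜ-refl) a≤x))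

  rep-+ : ∀ x y → set (rep (x + y)) ≋ (set (rep x) ⊔ₛ set (rep y))
  rep-+ x y
    = (λ ((t , t≤) , v∈R) → Sum.map (λ p → (t , p) , v∈R) (λ p → (t , p) , v∈R)
        (atom-prime (proj₂ (atoms t 2F)) t≤))
    , [ rep-mono (x≤x+y x y) , rep-mono (y≤x+y x y) ]′

  rep-¯ : ∀ x → set (rep (¯ x)) ≋ set (Rl.¯ rep x)
  rep-¯ x
    = (λ {v} v∈@((t , t≤) , p , p-end , f) → ⊑V (rep (¯ x)) v∈ , λ v∈x →
        atom-disjoint (proj₂ (atoms (end p) 2F)) (rep⁻ p f v∈x) (rep⁻ p f v∈))
    , (λ ((t , p , p-end , f) , v∉) → (t ,
        fromInj₂ (λ t≤x → contradiction ((t , t≤x) , p , p-end , f) v∉)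
          (atom-≤-or-≤¯ (proj₂ (atoms t 2F)) x)) , p , p-end , f)

  rep-1′ : set (rep 1′) ≋ set (Rl.𝐝 0F 1F)
  rep-1′
    = (λ v∈@((t , t≤) , p , p-end , f) → ⊑V (rep 1′) v∈ , ≈ₜ-trans (f 0F)
        (≈ₜ-trans (label⇒≈ₜ p 0F 1F (rep⁻ p f v∈)) (≈ₜ-sym (f 1F))))
    , (λ ((t , p , p-end , f) , e) → rep⁺ p f
        (≈ₜ⇒label-identity p 0F 1F (≈ₜ-trans (≈ₜ-sym (f 0F)) (≈ₜ-trans e (f 1F)))))

  private
    repᴿᵃ : Carrier → RaRl.Carrier
    repᴿᵃ x = rep x , rep-Nr₂ x

  rep-⨾ : ∀ x y → set (rep (x ⨾ y)) ≋ set (proj₁ (repᴿᵃ x RaRl.⨾ repᴿᵃ y))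
  rep-⨾ x y = to , from
    where
    X₁ Y₀ X Y : RlSet
    X₁ = Rl.𝐝 1F 2F Rl.· rep x
    Y₀ = Rl.𝐝 0F 2F Rl.· rep y
    X  = Rl.𝐜 1F X₁
    Y  = Rl.𝐜 0F Y₀

    to : set (rep (x ⨾ y)) ⊑ set (Rl.𝐜 2F (X Rl.· Y))
    to {v} v∈@(_ , p , _ , f) =
      let a≤x⨾y = rep⁻ p f v∈
          b , b-atom , b≤x , a≤b⨾y = splitˡ (label-atom (end p) 0F 1F) a≤x⨾y
          d , d-atom , d≤y , a≤b⨾d = splitʳ (label-atom (end p) 0F 1F) a≤b⨾y
          -- The triangle on the edge 01 of `end p` whose new vertex 2 splits it into `b` and `d`.
          s = triangle ((d , d-atom) ˘ᵃ) (b , b-atom) (atoms (end p) 2F)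
                (cycleʳ b-atom (label-atom (end p) 0F 1F) a≤b⨾d)
          q , q-end , g = step-to p 2F s ≈-refl
          -- The new vertex is moved into coordinate 1 to witness `x`, and into coordinate 0 to
          -- witness `y`.
          q₁ , q₁≈ , g₁ = copy q 1F 2F λ ()
          q₀ , q₀≈ , g₀ = copy q 0F 2F λ ()
      in ⊑V (rep (x ⨾ y)) v∈ , triple q
       , ·⁺ X Y
           (triple∈V q , triple q₁ , ·⁺ (Rl.𝐝 1F 2F) (rep x)
             (triple∈V q₁ , ≈ₜ-trans q₁≈ (≈ₜ-sym (g₁ 2F λ ())))
             (rep⁺ q₁ (λ _ → ≈ₜ-refl) (≤-respˡ-≈ (≈-sym (≈-trans
               (≈ₜ⇒label q₁ q {0F} {1F} {0F} {2F} (g₁ 0F λ ()) q₁≈) (q-end 1F))) b≤x))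
             , g₁)
           (triple∈V q , triple q₀ , ·⁺ (Rl.𝐝 0F 2F) (rep y)
             (triple∈V q₀ , ≈ₜ-trans q₀≈ (≈ₜ-sym (g₀ 2F λ ())))
             (rep⁺ q₀ (λ _ → ≈ₜ-refl) (≤-respˡ-≈ (≈-sym (≈-trans
               (≈ₜ⇒label q₀ q {0F} {1F} {2F} {1F} q₀≈ (g₀ 1F λ ()))
               (≈-trans (˘-cong (q-end 0F)) (˘-involutive d)))) d≤y))
             , g₀)
       , λ ν ν≢2 → ≈ₜ-trans (g ν ν≢2) (≈ₜ-sym (f ν))

    from : set (Rl.𝐜 2F (X Rl.· Y)) ⊑ set (rep (x ⨾ y))
    from {v} ((_ , p , _ , f) , w , w∈ , g) =
      let ((_ , q , _ , h) , w₁ , w₁∈ , g₁) , (_ , w₀ , w₀∈ , g₀) = ·⁻ X Y w∈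
          (_ , d₁) , w₁∈x = ·⁻ (Rl.𝐝 1F 2F) (rep x) w₁∈
          (_ , d₀) , w₀∈y = ·⁻ (Rl.𝐝 0F 2F) (rep y) w₀∈
          q≈w = λ κ → ≈ₜ-sym (h κ)
          -- In the triangle of the intermediate point `w`, edge 02 lies below `x` and edge 21 below
          -- `y`; the triangle law composes them.
          q≤x = rep-label q 0F 2F w₁∈x
            (≈ₜ-trans (q≈w 0F) (≈ₜ-sym (g₁ 0F λ ())))
            (≈ₜ-trans (q≈w 2F) (≈ₜ-trans (≈ₜ-sym (g₁ 2F λ ())) (≈ₜ-sym d₁)))
          q≤y = rep-label q 2F 1F w₀∈y
            (≈ₜ-trans (q≈w 2F) (≈ₜ-trans (≈ₜ-sym (g₀ 2F λ ())) (≈ₜ-sym d₀)))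
            (≈ₜ-trans (q≈w 1F) (≈ₜ-sym (g₀ 1F λ ())))
          p≈q = λ κ κ≢2 → ≈ₜ-trans (≈ₜ-sym (f κ)) (≈ₜ-trans (≈ₜ-sym (g κ κ≢2)) (h κ))
      in rep⁺ p f (≤-respˡ-≈
           (≈-sym (≈ₜ⇒label p q {0F} {1F} {0F} {1F} (p≈q 0F λ ()) (p≈q 1F λ ())))
           (≤-trans (label-triangle (end q) 0F 2F 1F) (⨾-mono q≤x q≤y)))

  rep-˘ : ∀ x → set (rep (x ˘)) ≋ set (proj₁ (repᴿᵃ x RaRl.˘))
  rep-˘ x = to , from
    where
    X₁ Y₁ X₀ Y₀ X₂ : RlSet
    X₁ = Rl.𝐝 1F 2F Rl.· rep x
    Y₁ = Rl.𝐜 1F X₁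
    X₀ = Rl.𝐝 0F 1F Rl.· Y₁
    Y₀ = Rl.𝐜 0F X₀
    X₂ = Rl.𝐝 2F 0F Rl.· Y₀

    to : set (rep (x ˘)) ⊑ set (Rl.𝐜 2F X₂)
    to v∈@(_ , p , _ , f) =
      -- Three copies exchange vertices 0 and 1, with coordinate 2 as temporary storage.
      let q₂ , q₂≈ , g₂ = copy p 2F 0F λ ()
          q₀ , q₀≈ , g₀ = copy q₂ 0F 1F λ ()
          q₁ , q₁≈ , g₁ = copy q₀ 1F 2F λ ()
          q₁0≈p1 = ≈ₜ-trans (g₁ 0F λ ()) (≈ₜ-trans q₀≈ (g₂ 1F λ ()))
          q₁1≈p0 = ≈ₜ-trans q₁≈ (≈ₜ-trans (g₀ 2F λ ()) q₂≈)
      in ⊑V (rep (x ˘)) v∈ , triple q₂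
       , ·⁺ (Rl.𝐝 2F 0F) Y₀
           (triple∈V q₂ , ≈ₜ-trans q₂≈ (≈ₜ-sym (g₂ 0F λ ())))
           (triple∈V q₂ , triple q₀ , ·⁺ (Rl.𝐝 0F 1F) Y₁
             (triple∈V q₀ , ≈ₜ-trans q₀≈ (≈ₜ-sym (g₀ 1F λ ())))
             (triple∈V q₀ , triple q₁ , ·⁺ (Rl.𝐝 1F 2F) (rep x)
               (triple∈V q₁ , ≈ₜ-trans q₁≈ (≈ₜ-sym (g₁ 2F λ ())))
               (rep⁺ q₁ (λ _ → ≈ₜ-refl) (≤-respˡ-≈
                 (≈-sym (≈ₜ⇒label q₁ p {0F} {1F} {1F} {0F} q₁0≈p1 q₁1≈p0))
                 (≤-respʳ-≈ (˘-involutive x) (˘-mono (rep⁻ p f v∈)))))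
               , g₁)
             , g₀)
       , λ ν ν≢2 → ≈ₜ-trans (g₂ ν ν≢2) (≈ₜ-sym (f ν))

    from : set (Rl.𝐜 2F X₂) ⊑ set (rep (x ˘))
    from ((_ , p , _ , f) , w₂ , w₂∈ , g₂) =
      let (_ , d₂) , (_ , w₀ , w₀∈ , g₀) = ·⁻ (Rl.𝐝 2F 0F) Y₀ w₂∈
          (_ , d₀) , (_ , w₁ , w₁∈ , g₁) = ·⁻ (Rl.𝐝 0F 1F) Y₁ w₀∈
          (_ , d₁) , w₁∈x = ·⁻ (Rl.𝐝 1F 2F) (rep x) w₁∈
          p0≈w₂0 = ≈ₜ-trans (≈ₜ-sym (f 0F)) (≈ₜ-sym (g₂ 0F λ ()))
          p1≈w₂1 = ≈ₜ-trans (≈ₜ-sym (f 1F)) (≈ₜ-sym (g₂ 1F λ ()))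
          w₂1≈w₁0 = ≈ₜ-trans (≈ₜ-sym (g₀ 1F λ ())) (≈ₜ-trans (≈ₜ-sym d₀) (≈ₜ-sym (g₁ 0F λ ())))
          w₂0≈w₁1 = ≈ₜ-trans (≈ₜ-sym d₂) (≈ₜ-trans (≈ₜ-sym (g₀ 2F λ ()))
                      (≈ₜ-trans (≈ₜ-sym (g₁ 2F λ ())) (≈ₜ-sym d₁)))
      in rep⁺ p f (˘-swap (rep-label p 1F 0F w₁∈x
           (≈ₜ-trans p1≈w₂1 w₂1≈w₁0) (≈ₜ-trans p0≈w₂0 w₂0≈w₁1)))

  -- Otherwise `¯ a` bounds all members of `P`, hence their supremum, and `a ≤ ¯ a`.
  atom-≤-supremum : ∀ {a s r} {P : Pred Carrier r} → IsAtom a → IsSupremum P s → a ≤ s →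
                    ∃ λ x → x ∈ P × a ≤ x
  atom-≤-supremum {a} {P = P} atom (_ , least) a≤s = decidable-stable em λ none →
    contradiction (≤-trans a≤s (least (¯ a) λ x x∈ → ¯-swap
      (fromInj₂ (λ a≤x → contradiction (x , x∈ , a≤x) none) (atom-≤-or-≤¯ atom x))))
      (atom-irrefl atom)

  -- The preimage is the supremum of the 01-atoms of those triangles whose one-triangle trail lies
  -- in `X`.
  rep-surjective : ∀ X → Rl.Nr₂ X → ∃ λ x → ∀ {z} → z ≈ x → set (rep z) ≋ set X
  rep-surjective X (X-closed , _) = x , λ z≈x → to z≈x , from z≈x
    where
    P : Pred Carrier (c ⊔ ℓ)
    P a = ∃ λ t → t $ 2F ≈ a × triple (root t) ∈ Mem (set X)

    x : Carrier
    x = proj₁ (complete P)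

    to : ∀ {z} → z ≈ x → set (rep z) ⊑ set X
    to z≈x v∈@(_ , p , _ , f) =
      -- The atom of `p` below the supremum equals that of some `t` in the defining set, so `t` and
      -- `end p` share edge 01. Closure of `X` under cylindrification along 2 then carries
      -- membership across.
      let a , (t , t≈a , t∈X) , p≤a = atom-≤-supremum (label-atom (end p) 0F 1F)
            (proj₂ (complete P)) (≤-respʳ-≈ z≈x (rep⁻ p f v∈))
          q , q-end , g = step-to (root t) 2F (end p) (≈-sym
            (atoms-≤⇒≈ (label-atom (end p) 0F 1F) (label-atom t 0F 1F) (≤-respʳ-≈ (≈-sym t≈a) p≤a)))
      in R-minimal (end p) (∈S X) (q , q-end , λ _ → ≈ₜ-refl)
           (X-closed (triple∈V q , triple (root t) , t∈X , λ ν ν≢2 → ≈ₜ-sym (g ν ν≢2)))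
           (p , ≈ᵇ-refl , f)

    from : ∀ {z} → z ≈ x → set X ⊑ set (rep z)
    from z≈x v∈ =
      let t , v∈R = ⊑V X v∈ in
      (t , ≤-respʳ-≈ (≈-sym z≈x) (proj₁ (proj₂ (complete P)) _
        (t , ≈-refl , R-minimal t (∈S X) v∈R v∈ (R-nonempty t)))) , v∈R

  isomorphism : 𝔄 ≅ Ra Rl hasNr₂
  isomorphism = record
    { ⟦_⟧        = repᴿᵃ
    ; cong       = λ x≈y → rep-mono (≤-reflexive x≈y) , rep-mono (≤-reflexive (≈-sym x≈y))
    ; +-homo     = rep-+
    ; ¯-homo     = rep-¯
    ; ⨾-homo     = rep-⨾
    ; ˘-homo     = rep-˘
    ; 1′-homo    = rep-1′
    ; injective  = λ (x⊑y , y⊑x) → ≤-antisym (rep-reflects-≤ x⊑y) (rep-reflects-≤ y⊑x)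
    ; surjective = λ (X , X∈Nr₂) → rep-surjective X X∈Nr₂
    }

  -- Atoms of the relativized algebra.

  ∉0 : ∀ {v} → ¬ (v ∈ Mem (set Rl.0#))
  ∉0 (v∈V , v∉1) = v∉1 (inj₁ (v∈V , ≈ₜ-refl))

  empty⇒≈0 : ∀ X → ¬ (∃ λ v → v ∈ Mem (set X)) → X Rl.≈ Rl.0#
  empty⇒≈0 X empty = (λ v∈ → contradiction (_ , v∈) empty) , λ v∈0 → contradiction v∈0 ∉0

  atom⇔R : ∀ X → Rl.IsAtom X ⇔ ∃ λ t → X Rl.≈ Rᵉ t
  atom⇔R X = mk⇔ to from
    where
    to : Rl.IsAtom X → ∃ λ t → X Rl.≈ Rᵉ t
    to (X≉0 , minimal) =
      -- A point of `X` lies in some `R t`; by homogeneity `X` contains all of `R t`, and minimality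
      -- makes them equal.
      let v , v∈ = decidable-stable em (X≉0 ∘ empty⇒≈0 X)
          t , v∈R = ⊑V X v∈
          Rt⊑X = R-minimal t (∈S X) v∈R v∈
      in t , [ (λ Rt≈0 → contradiction (proj₁ Rt≈0 (R-nonempty t)) ∉0) , Product.swap ]′
           (minimal (Rᵉ t) ([ Rt⊑X , (λ w∈ → w∈) ]′ , inj₂))

    from : (∃ λ t → X Rl.≈ Rᵉ t) → Rl.IsAtom X
    from (t , X⊑Rt , Rt⊑X)
      = (λ X≈0 → ∉0 (proj₁ X≈0 (Rt⊑X (R-nonempty t))))
      , minimal
      where
      minimal : ∀ Y → Y Rl.≤ X → Y Rl.≈ Rl.0# ⊎ Y Rl.≈ X
      minimal Y (Y⊑X , _) with em {P = ∃ λ v → v ∈ Mem (set Y)}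
      ... | no empty = inj₁ (empty⇒≈0 Y empty)
      ... | yes (v , v∈) = inj₂
        ((λ w∈ → Y⊑X (inj₁ w∈)) , λ w∈ → R-minimal t (∈S Y) (X⊑Rt (Y⊑X (inj₁ v∈))) v∈ (X⊑Rt w∈))

theorem6 : ∀ (em : ∀ {p} → ExcludedMiddle p) {c ℓ} (𝔄 : RawRA c ℓ) (isWA : IsWA 𝔄) →
    RawRA.IsComplete 𝔄 → RawRA.IsAtomic 𝔄 →
    let open Representation em 𝔄 isWA in
    (𝔄 ≅ Ra Rl hasNr₂) ×
    (∀ X → RawCA₃.IsAtom Rl X ⇔ ∃ λ t → RawCA₃._≈_ Rl X (Rᵉ t))
theorem6 em 𝔄 isWA complete atomic = isomorphism , atom⇔R
  where open RepresentationTheorem em isWA complete atomic
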